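{- The permutations $(213)$ and $(132)$ are shape-Wilf-equivalent, i.e. $|S_Y(213)|=|S_Y(132)|$ for all Young diagrams $Y$. Consequently, for any $n\ge 3$ and any permutation $\tau\in S_{n-3}$, the permutations $(n-1,n-2,n,\tau)$ and $(n-2,n,n-1,\tau)$ of $\{1,\dots,n\}$ are Wilf-equivalent, i.e. $|S_N(n-1,n-2,n,\tau)|=|S_N(n-2,n,n-1,\tau)|$ for all positive integers $N$.
   Context: Permutations are written in one-line notation; $(n-1,n-2,n,\tau)$ denotes the permutation $(n-1,n-2,n,\tau(1),\dots,\tau(n-3))$, and similarly for $(n-2,n,n-1,\tau)$. A permutation $\pi\in S_N$ contains $\tau\in S_k$ if some subsequence $\pi(j_1),\dots,\pi(j_k)$ with $j_1<\dots<j_k$ is in the same relative order as $\tau(1),\dots,\tau(k)$; otherwise $\pi$ avoids $\tau$. $S_N(\tau)$ is the set of permutations in $S_N$ avoiding $\tau$. Two permutations $\tau,\sigma$ are Wilf-equivalent if $|S_N(\tau)|=|S_N(\sigma)|$ for all positive integers $N$. Young diagrams are drawn with left-justified rows of weakly decreasing lengths from top to bottom; rows are numbered from the top and columns from the left. A transversal $T$ of a Young diagram $Y$ is a filling of its cells with 0's and 1's having exactly one 1 in every row and every column of $Y$. $T$ contains $\tau\in S_k$ if there are $k$ 1's of $T$, in columns $c_1<\dots<c_k$ and rows $r_1,\dots,r_k$ respectively, such that (a) the 1 in column $c_a$ is in a strictly higher row (nearer the top) than the 1 in column $c_b$ if and only if $\tau(a)>\tau(b)$, and (b) all the rows and columns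 through these 1's intersect inside $Y$; equivalently, the cell in row $\max_j r_j$ (the lowest of these rows) and column $c_k$ belongs to $Y$. Otherwise $T$ avoids $\tau$. $S_Y(\tau)$ is the set of all transversals of $Y$ that avoid $\tau$. Two permutations $\tau$ and $\sigma$ are shape-Wilf-equivalent if $|S_Y(\tau)|=|S_Y(\sigma)|$ for all Young diagrams $Y$. -}

module Defs where

open import Data.Bool.Base using (Bool; true)
open import Data.Fin.Base using (Fin; toℕ; _↑ˡ_; _↑ʳ_)
  renaming (_<_ to _<ᶠ_; _≤_ to _≤ᶠ_)
open import Data.Fin.Patterns using (0F; 1F; 2F)
open import Data.Fin.Permutation
  using (Permutation; Permutation′; _⟨$⟩ʳ_; transpose; cast-id)
open import Data.Fin.Properties
  using (+↔⊎; toℕ-cast; toℕ-↑ˡ; toℕ-↑ʳ)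
open import Data.List.Base using (List; []; _∷_; tabulate)
open import Data.List.Properties using (tabulate-cong)
open import Data.Nat.Base using (ℕ; suc; _+_; _∸_; _<_; _≤_; NonZero)
open import Data.Nat.Properties using (+-comm)
open import Data.Product.Base using (Σ; ∃-syntax; _×_; proj₁; proj₂)
open import Data.Product using (∃!)
open import Data.Sum.Base using (_⊎_)
open import Data.Sum.Algebra using (⊎-comm)
open import Data.Sum.Function.Propositional using (_⊎-↔_)
open import Function.Bundles using (_⇔_; _↔_; Inverse)
open import Function.Construct.Composition using (_↔-∘_)
open import Function.Construct.Symmetry using (↔-sym)
open import Level using (0ℓ)
open import Relation.Binary.Bundles using (Setoid)
import Relation.Binary.Construct.On as On
open import Relation.Binary.PropositionalEquality
  using (_≡_; refl; trans; cong; cong₂; _→-setoid_)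
open import Relation.Nullary using (¬_)

private
  variable
    k l m n N : ℕ

-- Permutations and transversals are functions, so the sets of them are
-- setoids under pointwise equality.  |A| = |B| is the existence of a
-- bijection that respects these equalities, with a two-sided inverse.

SameCardinality : Setoid 0ℓ 0ℓ → Setoid 0ℓ 0ℓ → Set
SameCardinality A B = Inverse A B

------------------------------------------------------------------------
-- Permutations: positions and values are numbered from 0.

PermContains : Permutation′ N → Permutation′ k → Set
PermContains {N} {k} π τ =
  Σ (Fin k → Fin N) λ j →
    (∀ {a b} → a <ᶠ b → j a <ᶠ j b) ×
    (∀ a b → (π ⟨$⟩ʳ j a) <ᶠ (π ⟨$⟩ʳ j b) ⇔ (τ ⟨$⟩ʳ a) <ᶠ (τ ⟨$⟩ʳ b))

PermAvoids : Permutation′ N → Permutation′ k → Set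
PermAvoids π τ = ¬ PermContains π τ

permSetoid : ℕ → Setoid 0ℓ 0ℓ
permSetoid N = On.setoid (Fin N →-setoid Fin N) _⟨$⟩ʳ_

-- Equality in S[ N ] τ ignores the proof of avoidance.
S[_] : ∀ N → Permutation′ k → Setoid 0ℓ 0ℓ
S[ N ] τ = On.setoid {B = Σ (Permutation′ N) (λ π → PermAvoids π τ)}
                     (permSetoid N) proj₁

WilfEquivalent : Permutation′ k → Permutation′ l → Set
WilfEquivalent τ σ = ∀ N → .{{NonZero N}} → SameCardinality (S[ N ] τ) (S[ N ] σ)

------------------------------------------------------------------------
-- Young diagrams and their transversals: rows are numbered from the top
-- and columns from the left, both from 0.

record YoungDiagram : Set where
  field
    #rows      : ℕ
    rowLength  : Fin #rows → ℕ
    positive   : ∀ r → 0 < rowLength r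
    decreasing : ∀ {r s} → r ≤ᶠ s → rowLength s ≤ rowLength r

open YoungDiagram public

Cell : YoungDiagram → Set
Cell Y = Σ (Fin (#rows Y)) (λ r → Fin (rowLength Y r))

module _ {Y : YoungDiagram} where

  row : Cell Y → Fin (#rows Y)
  row = proj₁

  col : Cell Y → ℕ
  col x = toℕ (proj₂ x)

IsColumn : YoungDiagram → ℕ → Set
IsColumn Y c = ∃[ r ] c < rowLength Y r

-- true marks the cells containing a 1.
Filling : YoungDiagram → Set
Filling Y = Cell Y → Bool

record IsTransversal (Y : YoungDiagram) (T : Filling Y) : Set where
  field
    one-per-row    : ∀ r → ∃! _≡_ λ (x : Cell Y) → row {Y} x ≡ r × T x ≡ true
    one-per-column : ∀ c → IsColumn Y c →
                     ∃! _≡_ λ (x : Cell Y) → col {Y} x ≡ c × T x ≡ true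

record Contains (Y : YoungDiagram) (T : Filling Y) (τ : Permutation′ k) : Set where
  field
    at         : Fin k → Cell Y
    ones       : ∀ a → T (at a) ≡ true
    increasing : ∀ {a b} → a <ᶠ b → col {Y} (at a) < col {Y} (at b)
    -- A higher row has a smaller index, hence the reversal.
    same-order : ∀ a b → row {Y} (at a) <ᶠ row {Y} (at b) ⇔
                         (τ ⟨$⟩ʳ b) <ᶠ (τ ⟨$⟩ʳ a)
    inside     : ∀ a b → col {Y} (at b) < rowLength Y (row {Y} (at a))

Avoids : (Y : YoungDiagram) → Filling Y → Permutation′ k → Set
Avoids Y T τ = ¬ Contains Y T τ

S⟨_⟩ : YoungDiagram → Permutation′ k → Setoid 0ℓ 0ℓ
S⟨ Y ⟩ τ = On.setoid {B = Σ (Filling Y) λ T → IsTransversal Y T × Avoids Y T τ}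
                     (Cell Y →-setoid Bool) proj₁

ShapeWilfEquivalent : Permutation′ k → Permutation′ l → Set
ShapeWilfEquivalent τ σ = ∀ Y → SameCardinality (S⟨ Y ⟩ τ) (S⟨ Y ⟩ σ)

------------------------------------------------------------------------

⟨213⟩ ⟨132⟩ : Permutation′ 3
⟨213⟩ = transpose 0F 1F
⟨132⟩ = transpose 1F 2F

-- (ρ(1)+m, …, ρ(k)+m, τ(1), …, τ(m)) for ρ ∈ S_k and τ ∈ S_m.
infixr 6 _⊖_
_⊖_ : Permutation′ k → Permutation′ m → Permutation′ (k + m)
_⊖_ {k} {m} ρ τ =
  below-above ↔-∘ ((ρ ⊎-↔ τ) ↔-∘ +↔⊎)
  where
  below-above : (Fin k ⊎ Fin m) ↔ Fin (k + m)
  below-above = cast-id (+-comm m k) ↔-∘ (↔-sym +↔⊎ ↔-∘ ⊎-comm (Fin k) (Fin m))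

-- With n = 3 + m and τ ∈ S_m.
⟨n-1,n-2,n,_⟩ ⟨n-2,n,n-1,_⟩ : Permutation′ m → Permutation′ (3 + m)
⟨n-1,n-2,n, τ ⟩ = ⟨213⟩ ⊖ τ
⟨n-2,n,n-1, τ ⟩ = ⟨132⟩ ⊖ τ

-- Values are shifted to {1,…,n}, so that the lemmas below give the usual one-line notation.
oneLine : Permutation′ n → List ℕ
oneLine π = tabulate (λ i → suc (toℕ (π ⟨$⟩ʳ i)))

oneLine-213 : oneLine ⟨213⟩ ≡ 2 ∷ 1 ∷ 3 ∷ []
oneLine-213 = refl

oneLine-132 : oneLine ⟨132⟩ ≡ 1 ∷ 3 ∷ 2 ∷ []
oneLine-132 = refl

private
  large : ∀ m (a : Fin 3) → toℕ (cast-id (+-comm m 3) ⟨$⟩ʳ (m ↑ʳ a)) ≡ toℕ a + m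
  large m a = trans (toℕ-cast (+-comm m 3) (m ↑ʳ a))
                    (trans (toℕ-↑ʳ m a) (+-comm m (toℕ a)))

  small : ∀ m (b : Fin m) → toℕ (cast-id (+-comm m 3) ⟨$⟩ʳ (b ↑ˡ 3)) ≡ toℕ b
  small m b = trans (toℕ-cast (+-comm m 3) (b ↑ˡ 3)) (toℕ-↑ˡ b 3)

  tail-values : ∀ (τ : Permutation′ m) →
    tabulate (λ i → suc (toℕ (cast-id (+-comm m 3) ⟨$⟩ʳ ((τ ⟨$⟩ʳ i) ↑ˡ 3)))) ≡ oneLine τ
  tail-values {m} τ = tabulate-cong (λ i → cong suc (small m (τ ⟨$⟩ʳ i)))

oneLine-n-1,n-2,n : ∀ {m} (τ : Permutation′ m) → let n = 3 + m in
  oneLine ⟨n-1,n-2,n, τ ⟩ ≡ (n ∸ 1) ∷ (n ∸ 2) ∷ n ∷ oneLine τ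
oneLine-n-1,n-2,n {m} τ =
  cong₂ _∷_ (cong suc (large m 1F)) (cong₂ _∷_ (cong suc (large m 0F))
    (cong₂ _∷_ (cong suc (large m 2F)) (tail-values τ)))

oneLine-n-2,n,n-1 : ∀ {m} (τ : Permutation′ m) → let n = 3 + m in
  oneLine ⟨n-2,n,n-1, τ ⟩ ≡ (n ∸ 2) ∷ n ∷ (n ∸ 1) ∷ oneLine τ
oneLine-n-2,n,n-1 {m} τ =
  cong₂ _∷_ (cong suc (large m 0F)) (cong₂ _∷_ (cong suc (large m 2F))
    (cong₂ _∷_ (cong suc (large m 1F)) (tail-values τ)))

{-# OPTIONS --safe #-}
module Submission where

-- Walk along the border of the diagram from its bottom left corner: an east
-- step inserts the new column into the list of open columns, ordered by their
-- rows, and a north step closes the column of the lowest open row.  The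
-- placement avoids 132 exactly when each column is inserted between two skew
-- components ("blocks") of the current list; it then merges with the blocks
-- below it.  So a 132-avoiding placement is a Dyck path with a number (of
-- blocks merged) on each east step.  Over a balanced stretch D of the path the
-- blocks change only by a merger of the bottom merged D + 1 of them, where
-- merged is additive under concatenation and on an arch depends only on its
-- number and on the value of merged inside.  Hence reversing the path, with each
-- number kept on its arch, preserves validity.  The reversed
-- path is the border of the transposed diagram, and transposition turns 132
-- into 213.
--
-- For σ ⊖ τ with σ of length 3, the exchange is applied to the ones that have a
-- copy of τ strictly below and to the right; this region is a Young shape, and
-- it does not change because it is determined by the ones outside of it.

open import Defs
open import Data.Bool.Base using (Bool; true; false; if_then_else_)
open import Data.Empty using (⊥)
open import Data.Fin.Base
  using (Fin; zero; suc; toℕ; fromℕ; fromℕ<; opposite; _↑ˡ_; _↑ʳ_; splitAt; join; finToFun; funToFin)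
  renaming (_<_ to _<ᶠ_; _≤_ to _≤ᶠ_)
open import Data.Fin.Patterns using (0F; 1F; 2F)
open import Data.Fin.Permutation
  using (Permutation′; permutation; _⟨$⟩ʳ_; _⟨$⟩ˡ_; inverseˡ; inverseʳ)
import Data.Fin.Properties as Fin
open import Data.List.Base
  using (List; []; _∷_; _++_; length; map; take; drop; filter; upTo; downFrom)
open import Data.List.Membership.Propositional using (_∈_; _∉_)
open import Data.List.Membership.Propositional.Properties
  using (∈-++⁺ˡ; ∈-++⁺ʳ; ∈-++⁻; ∈-upTo⁺; ∈-upTo⁻; ∈-downFrom⁺; ∈-downFrom⁻; ∈-filter⁺; ∈-filter⁻)
open import Data.List.Properties
  using (length-++; length-map; length-drop; drop-drop; drop-map; ++-identityʳ; ++-assoc; filter-≐)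
open import Data.List.Relation.Unary.All as All using (All; []; _∷_)
import Data.List.Relation.Unary.All.Properties as All
open import Data.List.Relation.Unary.AllPairs using (AllPairs; []; _∷_)
import Data.List.Relation.Unary.AllPairs.Properties as AllPairs
open import Data.List.Relation.Unary.Any using (here; there)
open import Data.Nat.Base
  using (ℕ; zero; suc; _+_; _∸_; _≤_; _<_; _>_; z≤n; s≤s)
open import Data.Nat.Properties
open import Data.List.Membership.DecPropositional _≟_ using (_∈?_)
open import Data.Product.Base using (Σ; ∃-syntax; ∃₂; _×_; _,_; proj₁; proj₂; map₁)
open import Data.Sum.Base using (_⊎_; inj₁; inj₂)
open import Data.Unit.Base using (⊤; tt)
open import Data.Vec.Functional using () renaming (_++_ to _⧺_)
open import Data.Vec.Functional.Properties using (lookup-++ˡ; lookup-++ʳ)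
open import Function.Base using (_∘_; id; flip)
open import Function.Bundles using (_⇔_; mk⇔; Inverse; module Equivalence)
open import Level using (0ℓ)
open import Relation.Binary.Bundles using (Setoid)
open import Relation.Binary.Core using (Rel)
open import Relation.Binary.Definitions using (tri<; tri≈; tri>)
open import Relation.Binary.PropositionalEquality
open import Relation.Nullary using (¬_; Dec; yes; no; does; contradiction)
open import Relation.Nullary.Decidable using (map′; dec-true; does-⇔; _×-dec_; _→-dec_)

open Equivalence using (to; from)

-- Labelled Dyck paths and their reversal

-- `c` and `r` name the column and the row traversed. Labels in `⊤` give the bare border path
-- (`Path`).
data Step (A : Set) : Set where
  east  : (c : ℕ) → A → Step A
  north : (r : ℕ) → Step A

Walk : Set
Walk = List (Step ℕ)

-- Blocks are listed from the bottom by their sizes minus one: size b k s belongs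
-- to the merger of b with the first k blocks of s (with all of them if k is too
-- large).
size : ℕ → ℕ → List ℕ → ℕ
size b zero    s       = b
size b (suc k) []      = b
size b (suc k) (x ∷ s) = size (suc (b + x)) k s

size-+ : ∀ b k l s → size (size b k s) l (drop k s) ≡ size b (k + l) s
size-+ b zero    l       s       = refl
size-+ b (suc k) zero    []      = refl
size-+ b (suc k) (suc l) []      = refl
size-+ b (suc k) l       (x ∷ s) = size-+ (suc (b + x)) k l s

size-suc : ∀ b k s → size (suc b) k s ≡ suc (size b k s)
size-suc b zero    s       = refl
size-suc b (suc k) []      = refl
size-suc b (suc k) (x ∷ s) = size-suc (suc (b + x)) k s

-- The inserted column is a new block 0, merged with the i blocks below it.
Valid : Walk → List ℕ → Set
Valid []             []          = ⊤
Valid []             (_ ∷ _)     = ⊥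
Valid (east c i ∷ q) s           = i ≤ length s × Valid q (size 0 i s ∷ drop i s)
Valid (north r ∷ q)  []          = ⊥
Valid (north r ∷ q)  (zero ∷ s)  = Valid q s
Valid (north r ∷ q)  (suc b ∷ s) = Valid q (b ∷ s)

-- Not unique for a given walk, as concatenation is formal.
data Dyck : Set where
  ε    : Dyck
  _·_  : Dyck → Dyck → Dyck
  arch : (c i : ℕ) → Dyck → (r : ℕ) → Dyck

infixr 5 _·_

walk : Dyck → Walk → Walk
walk ε              q = q
walk (D · D′)       q = walk D (walk D′ q)
walk (arch c i D r) q = east c i ∷ walk D (north r ∷ q)

rev : Dyck → Dyck
rev ε              = ε
rev (D · D′)       = rev D′ · rev D
rev (arch c i D r) = arch r i (rev D) c

-- Below an arch, the new column and i + merged D old blocks become one, which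
-- then loses an element.  For i + merged D = 0 that was the column itself, so this
-- has the same effect as i + merged D = 1: the truncated subtraction is intended.
merged : Dyck → ℕ
merged ε              = 0
merged (D · D′)       = merged D + merged D′
merged (arch c i D r) = i + merged D ∸ 1

OnGround : Dyck → Set
OnGround ε              = ⊤
OnGround (D · D′)       = OnGround D × OnGround D′
OnGround (arch c i D r) = i + merged D ≤ 0

-- The block of the new column loses one element. For `j = 0` this is the column itself, and `b ∷ s`
-- is untouched; for `j = suc k` the column has joined `b`, and the loss cancels its contribution to
-- the size.
Valid-pop : ∀ j r q b s → Valid (north r ∷ q) (size 0 j (b ∷ s) ∷ drop j (b ∷ s)) ≡
                          Valid q (size b (j ∸ 1) s ∷ drop (j ∸ 1) s)
Valid-pop zero    r q b s = refl
Valid-pop (suc k) r q b s = cong (λ x → Valid (north r ∷ q) (x ∷ drop k s)) (size-suc b k s)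

bounds-to : ∀ {i k n} → i ≤ suc n → k ≤ suc n ∸ i → i + k ∸ 1 ≤ n
bounds-to {i} {k} {n} i≤ k≤ =
  ∸-monoˡ-≤ 1 (≤-trans (+-monoʳ-≤ i k≤) (≤-reflexive (m+[n∸m]≡n i≤)))

bounds-from : ∀ i {k n} → i + k ∸ 1 ≤ n → i ≤ suc n × k ≤ suc n ∸ i
bounds-from i {k} {n} h = ≤-trans (m≤m+n i k) i+k≤ ,
                          m+n≤o⇒m≤o∸n k (subst (_≤ suc n) (+-comm i k) i+k≤)
  where
  i+k≤ : i + k ≤ suc n
  i+k≤ = ≤-trans (m≤n+m∸n (i + k) 1) (s≤s h)

-- Induction on `D`. Successive mergers add up by `size-+`. On an arch the new block absorbs `i`
-- blocks of `b ∷ s`, the inner path `merged D` more, and `Valid-pop` performs the closing step. The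
-- block `b` is set apart because the bottom block survives, while blocks of `s` may be merged into
-- it.
Valid-walk : ∀ D {q b s} → Valid (walk D q) (b ∷ s) ⇔
             (merged D ≤ length s × Valid q (size b (merged D) s ∷ drop (merged D) s))
Valid-walk ε = mk⇔ (z≤n ,_) proj₂
Valid-walk (D · D′) {q} {b} {s} = mk⇔ forth back
  where
  k = merged D
  l = merged D′
  shift : (size (size b k s) l (drop k s) ∷ drop l (drop k s)) ≡ (size b (k + l) s ∷ drop (k + l) s)
  shift = cong₂ _∷_ (size-+ b k l s) (drop-drop k l s)
  forth : _ → _
  forth v with to (Valid-walk D) v
  ... | k≤ , v₁ with to (Valid-walk D′) v₁
  ...   | l≤ , v₂ = ≤-trans (+-monoʳ-≤ k (≤-trans l≤ (≤-reflexive (length-drop k s))))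
                            (≤-reflexive (m+[n∸m]≡n k≤))
                  , subst (Valid q) shift v₂
  back : _ → _
  back (kl≤ , v) = from (Valid-walk D)
    ( ≤-trans (m≤m+n k l) kl≤
    , from (Valid-walk D′)
        ( ≤-trans (≤-trans (≤-reflexive (sym (m+n∸m≡n k l))) (∸-monoˡ-≤ k kl≤))
                  (≤-reflexive (sym (length-drop k s)))
        , subst (Valid q) (sym shift) v))
Valid-walk (arch c i D r) {q} {b} {s} = mk⇔ forth back
  where
  k = merged D
  shift : (size (size 0 i (b ∷ s)) k (drop i (b ∷ s)) ∷ drop k (drop i (b ∷ s)))
        ≡ (size 0 (i + k) (b ∷ s) ∷ drop (i + k) (b ∷ s))
  shift = cong₂ _∷_ (size-+ 0 i k (b ∷ s)) (drop-drop i k (b ∷ s))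
  eq : Valid (north r ∷ q) (size (size 0 i (b ∷ s)) k (drop i (b ∷ s)) ∷ drop k (drop i (b ∷ s)))
     ≡ Valid q (size b (i + k ∸ 1) s ∷ drop (i + k ∸ 1) s)
  eq = trans (cong (Valid (north r ∷ q)) shift) (Valid-pop (i + k) r q b s)
  forth : _ → _
  forth (i≤ , v) with to (Valid-walk D) v
  ... | k≤ , v₁ = bounds-to i≤ (≤-trans k≤ (≤-reflexive (length-drop i (b ∷ s)))) , subst id eq v₁
  back : _ → _
  back (h , v) with bounds-from i h
  ... | i≤ , k≤ = i≤ , from (Valid-walk D)
                         ( ≤-trans k≤ (≤-reflexive (sym (length-drop i (b ∷ s))))
                         , subst id (sym eq) v)

-- On the empty list there is nothing to merge with: an outermost arch must carry 0, and its inner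
-- path starts from a single block, so `Valid-walk` with `s = []` allows only `merged D = 0`.
Valid-ground : ∀ D {q} → Valid (walk D q) [] ⇔ (OnGround D × Valid q [])
Valid-ground ε = mk⇔ (tt ,_) proj₂
Valid-ground (D · D′) {q} = mk⇔
  (λ v → let g , v₁ = to (Valid-ground D) v ; g′ , v₂ = to (Valid-ground D′) v₁ in (g , g′) , v₂)
  (λ ((g , g′) , v) → from (Valid-ground D) (g , from (Valid-ground D′) (g′ , v)))
Valid-ground (arch c zero D r) {q} = mk⇔
  (λ (_ , v) → let k≤ , v₁ = to (Valid-walk D) v in k≤ , subst id (lower k≤) v₁)
  (λ (k≤ , v) → z≤n , from (Valid-walk D) (k≤ , subst id (sym (lower k≤)) v))
  where
  lower : ∀ {k} → k ≤ 0 → Valid (north r ∷ q) (size 0 k [] ∷ drop k []) ≡ Valid q []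
  lower z≤n = refl
Valid-ground (arch c (suc i) D r) = mk⇔ (λ ()) (λ ())

-- A concatenation enters only through a sum, which is commutative, and an arch keeps its label.
-- This symmetry is why reversal preserves validity.
merged-rev : ∀ D → merged (rev D) ≡ merged D
merged-rev ε              = refl
merged-rev (D · D′)       = trans (+-comm (merged (rev D′)) (merged (rev D)))
                                  (cong₂ _+_ (merged-rev D) (merged-rev D′))
merged-rev (arch c i D r) = cong (λ k → i + k ∸ 1) (merged-rev D)

OnGround-rev : ∀ D → OnGround D → OnGround (rev D)
OnGround-rev ε              _        = tt
OnGround-rev (D · D′)       (g , g′) = OnGround-rev D′ g′ , OnGround-rev D g
OnGround-rev (arch c i D r) g        = subst (λ k → i + k ≤ 0) (sym (merged-rev D)) g

rev-involutive : ∀ D → rev (rev D) ≡ D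
rev-involutive ε              = refl
rev-involutive (D · D′)       = cong₂ _·_ (rev-involutive D) (rev-involutive D′)
rev-involutive (arch c i D r) = cong (λ X → arch c i X r) (rev-involutive D)

-- The rest of a path from height `n` on: balanced pieces separated by the `n` north steps that
-- close columns opened earlier.
data Suffix : ℕ → Walk → Set where
  done : ∀ D → Suffix 0 (walk D [])
  next : ∀ {n q} D r → Suffix n q → Suffix (suc n) (walk D (north r ∷ q))

prepend : ∀ {n q} c i D r → Suffix n q → Suffix n (east c i ∷ walk D (north r ∷ q))
prepend c i D r (done D′)      = done (arch c i D r · D′)
prepend c i D r (next D′ r′ f) = next (arch c i D r · D′) r′ f

-- The height of the path, that is, the number of open columns; `suc` undoes the shift in the block
-- sizes.
weight : List ℕ → ℕ
weight []      = 0
weight (b ∷ s) = suc (b + weight s)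

weight-size : ∀ b i s → weight (size b i s ∷ drop i s) ≡ weight (b ∷ s)
weight-size b zero    s       = refl
weight-size b (suc i) []      = refl
weight-size b (suc i) (x ∷ s) = trans (weight-size (suc (b + x)) i s)
  (cong suc (trans (cong suc (+-assoc b x (weight s))) (sym (+-suc b (x + weight s)))))

parse : ∀ q s → Valid q s → Suffix (weight s) q
parse []          []          v       = done ε
parse (east c i ∷ q) s           (_ , v) with subst (λ n → Suffix n q) (weight-size 0 i s) (parse q _ v)
-- By `weight-size` the height after the east step is `suc (weight s)`, so an unmatched north step
-- follows; the first one closes the new arch.
... | next D r f = prepend c i D r f
parse (north r ∷ q) (zero ∷ s)  v = next ε r (parse q s v)
parse (north r ∷ q) (suc b ∷ s) v = next ε r (parse q (b ∷ s) v)

Valid⇒Dyck : ∀ {q} → Valid q [] → ∃[ D ] q ≡ walk D []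
Valid⇒Dyck {q} v with parse q [] v
... | done D = D , refl

-- The stack holds the labels of the arches that are open; for valid walks it is
-- never empty at a north step.
reflectOnto : List ℕ → Walk → Walk → Walk
reflectOnto st       []             acc = acc
reflectOnto st       (east c i ∷ q) acc = reflectOnto (i ∷ st) q (north c ∷ acc)
reflectOnto []       (north r ∷ q)  acc = reflectOnto [] q (east r 0 ∷ acc)
reflectOnto (i ∷ st) (north r ∷ q)  acc = reflectOnto st q (east r i ∷ acc)

reflect : Walk → Walk
reflect q = reflectOnto [] q []

-- A balanced piece leaves the stack as it found it, so the label popped at the end of an arch is
-- the one pushed at its beginning.
reflectOnto-walk : ∀ D {st q acc} →
  reflectOnto st (walk D q) acc ≡ reflectOnto st q (walk (rev D) acc)
reflectOnto-walk ε              = refl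
reflectOnto-walk (D · D′)       = trans (reflectOnto-walk D) (reflectOnto-walk D′)
reflectOnto-walk (arch c i D r) = reflectOnto-walk D

reflect-walk : ∀ D → reflect (walk D []) ≡ walk (rev D) []
reflect-walk D = reflectOnto-walk D

reflect-Valid : ∀ {q} → Valid q [] → Valid (reflect q) []
reflect-Valid {q} v with Valid⇒Dyck {q} v
... | D , refl = subst (λ q → Valid q []) (sym (reflect-walk D))
                   (from (Valid-ground (rev D)) (OnGround-rev D (proj₁ (to (Valid-ground D) v)) , tt))

reflect-involutive : ∀ {q} → Valid q [] → reflect (reflect q) ≡ q
reflect-involutive {q} v with Valid⇒Dyck {q} v
... | D , refl = trans (cong reflect (reflect-walk D))
                   (trans (reflect-walk (rev D)) (cong (λ X → walk X []) (rev-involutive D)))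

-- Border paths

AllPairs-++⁻ : ∀ {X : Set} {R : Rel X 0ℓ} xs {ys} → AllPairs R (xs ++ ys) →
               AllPairs R xs × AllPairs R ys × All (λ x → All (R x) ys) xs
AllPairs-++⁻ []       ps       = [] , ps , []
AllPairs-++⁻ (x ∷ xs) (p ∷ ps) =
  let qs , rs , ss = AllPairs-++⁻ xs ps
  in  All.++⁻ˡ xs p ∷ qs , rs , All.++⁻ʳ xs p ∷ ss

AllPairs-insert : ∀ {X : Set} {R : Rel X 0ℓ} xs {c ys} →
                  AllPairs R (xs ++ ys) → All (λ x → R x c) xs → All (R c) ys →
                  AllPairs R (xs ++ c ∷ ys)
AllPairs-insert []       ps       _        q = q ∷ ps
AllPairs-insert (x ∷ xs) (p ∷ ps) (r ∷ rs) q =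
  All.++⁺ (All.++⁻ˡ xs p) (r ∷ All.++⁻ʳ xs p) ∷ AllPairs-insert xs ps rs q

AllPairs-remove : ∀ {X : Set} {R : Rel X 0ℓ} xs {c ys} → AllPairs R (xs ++ c ∷ ys) →
                  AllPairs R (xs ++ ys) × All (λ x → R x c) xs × All (R c) ys
AllPairs-remove []       (q ∷ ps) = ps , [] , q
AllPairs-remove (x ∷ xs) (p ∷ ps) with All.++⁻ʳ xs p
... | r ∷ r′ = let qs , rs , ss = AllPairs-remove xs ps
               in  All.++⁺ (All.++⁻ˡ xs p) r′ ∷ qs , r ∷ rs , ss

∈-insert⁻ : ∀ {X : Set} xs {x c : X} {ys} → x ∈ xs ++ c ∷ ys → x ≡ c ⊎ x ∈ xs ++ ys
∈-insert⁻ xs x∈ with ∈-++⁻ xs x∈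
... | inj₁ h         = inj₂ (∈-++⁺ˡ h)
... | inj₂ (here h)  = inj₁ h
... | inj₂ (there h) = inj₂ (∈-++⁺ʳ xs h)

∈-insert⁺ : ∀ {X : Set} xs {x c : X} {ys} → x ∈ xs ++ ys → x ∈ xs ++ c ∷ ys
∈-insert⁺ xs x∈ with ∈-++⁻ xs x∈
... | inj₁ h = ∈-++⁺ˡ h
... | inj₂ h = ∈-++⁺ʳ xs (there h)

Path : Set
Path = List (Step ⊤)

cols rows : ∀ {A : Set} → List (Step A) → List ℕ
cols []             = []
cols (east c _ ∷ p) = c ∷ cols p
cols (north _ ∷ p)  = cols p
rows []             = []
rows (east _ _ ∷ p) = rows p
rows (north r ∷ p)  = r ∷ rows p

erase : Walk → Path
erase []             = []
erase (east c _ ∷ q) = east c tt ∷ erase q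
erase (north r ∷ q)  = north r ∷ erase q

cols-erase : ∀ q → cols (erase q) ≡ cols q
cols-erase []             = refl
cols-erase (east c _ ∷ q) = cong (c ∷_) (cols-erase q)
cols-erase (north r ∷ q)  = cols-erase q

rows-erase : ∀ q → rows (erase q) ≡ rows q
rows-erase []             = refl
rows-erase (east c _ ∷ q) = rows-erase q
rows-erase (north r ∷ q)  = cong (r ∷_) (rows-erase q)

-- Y r c says that the cell in row r and column c belongs to the board.
Board : Set₁
Board = ℕ → ℕ → Set

module _ (Y : Board) where

  -- The path is the border of `Y` from the bottom left corner: among its rows and columns, a cell
  -- is on the board exactly when the east step of its column precedes the north step of its row.
  Sorted : ∀ {A : Set} → List (Step A) → Set
  Sorted []             = ⊤
  Sorted (east c _ ∷ p) = All (c <_) (cols p) × All (λ r → Y r c) (rows p) × Sorted p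
  Sorted (north r ∷ p)  = All (_< r) (rows p) × All (λ c → ¬ Y r c) (cols p) × Sorted p

  Sorted-erase : ∀ q → Sorted (erase q) → Sorted q
  Sorted-erase []             _           = tt
  Sorted-erase (east c _ ∷ q) (h , k , s) =
    subst (All _) (cols-erase q) h , subst (All _) (rows-erase q) k , Sorted-erase q s
  Sorted-erase (north r ∷ q)  (h , k , s) =
    subst (All _) (rows-erase q) h , subst (All _) (cols-erase q) k , Sorted-erase q s

turnOnto : Path → Path → Path
turnOnto []             acc = acc
turnOnto (east c _ ∷ p) acc = turnOnto p (north c ∷ acc)
turnOnto (north r ∷ p)  acc = turnOnto p (east r tt ∷ acc)

turn : Path → Path
turn p = turnOnto p []

turn-involutive : ∀ p → turn (turn p) ≡ p
turn-involutive p = trans (onto p [] []) (++-identityʳ p)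
  where
  onto : ∀ p acc acc′ → turnOnto (turnOnto p acc) acc′ ≡ turnOnto acc (p ++ acc′)
  onto []          acc acc′ = refl
  onto (east c _ ∷ p) acc acc′ = onto p (north c ∷ acc) acc′
  onto (north r ∷ p)   acc acc′ = onto p (east r tt ∷ acc) acc′

erase-reflect : ∀ q → erase (reflect q) ≡ turn (erase q)
erase-reflect q = onto [] q []
  where
  onto : ∀ st q acc → erase (reflectOnto st q acc) ≡ turnOnto (erase q) (erase acc)
  onto st       []          acc = refl
  onto st       (east c i ∷ q) acc = onto (i ∷ st) q (north c ∷ acc)
  onto []       (north r ∷ q)   acc = onto [] q (east r 0 ∷ acc)
  onto (i ∷ st) (north r ∷ q)   acc = onto st q (east r i ∷ acc)

∈-cols-turn : ∀ p {x} → x ∈ rows p → x ∈ cols (turn p)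
∈-cols-turn p x∈ = onto p [] (inj₁ x∈)
  where
  onto : ∀ p acc {x} → x ∈ rows p ⊎ x ∈ cols acc → x ∈ cols (turnOnto p acc)
  onto []          acc (inj₂ h)         = h
  onto (east c _ ∷ p) acc h                = onto p (north c ∷ acc) h
  onto (north r ∷ p)   acc (inj₁ (here e))  = onto p (east r tt ∷ acc) (inj₂ (here e))
  onto (north r ∷ p)   acc (inj₁ (there h)) = onto p (east r tt ∷ acc) (inj₁ h)
  onto (north r ∷ p)   acc (inj₂ h)         = onto p (east r tt ∷ acc) (inj₂ (there h))

∈-rows-turn : ∀ p {x} → x ∈ cols p → x ∈ rows (turn p)
∈-rows-turn p x∈ = onto p [] (inj₁ x∈)
  where
  onto : ∀ p acc {x} → x ∈ cols p ⊎ x ∈ rows acc → x ∈ rows (turnOnto p acc)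
  onto []          acc (inj₂ h)         = h
  onto (north r ∷ p)   acc h                = onto p (east r tt ∷ acc) h
  onto (east c _ ∷ p) acc (inj₁ (here e))  = onto p (north c ∷ acc) (inj₂ (here e))
  onto (east c _ ∷ p) acc (inj₁ (there h)) = onto p (north c ∷ acc) (inj₁ h)
  onto (east c _ ∷ p) acc (inj₂ h)         = onto p (north c ∷ acc) (inj₂ (there h))

Sorted-turn : ∀ {Y} p → Sorted Y p → Sorted (flip Y) (turn p)
Sorted-turn {Y} p s = onto p [] s tt (All.universal (λ _ → [] , []) _) (All.universal (λ _ → [] , []) _)
  where
  -- The last two hypotheses compare the columns and rows still ahead in `p` with those already
  -- moved to `acc`; each move extends them by what `Sorted Y` says about the step moved.
  onto : ∀ p acc → Sorted Y p → Sorted (flip Y) acc →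
         All (λ c → All (_< c) (rows acc) × All (λ r → ¬ Y r c) (cols acc)) (cols p) →
         All (λ r → All (r <_) (cols acc) × All (λ c → Y r c) (rows acc)) (rows p) →
         Sorted (flip Y) (turnOnto p acc)
  onto []          acc _           t _              _              = t
  onto (east c _ ∷ p) acc (h , k , s) t ((a , b) ∷ cs) rs             =
    onto p (north c ∷ acc) s (a , b , t)
      (All.zipWith (λ (c< , a , b) → c< ∷ a , b) (h , cs))
      (All.zipWith (λ (y , a , b) → a , y ∷ b) (k , rs))
  onto (north r ∷ p)   acc (h , k , s) t cs             ((a , b) ∷ rs) =
    onto p (east r tt ∷ acc) s (a , b , t)
      (All.zipWith (λ (n , a , b) → a , n ∷ b) (k , cs))
      (All.zipWith (λ (r< , a , b) → r< ∷ a , b) (h , rs))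

-- Runs of a placement along the border

-- (xs , z) is the block xs ++ z ∷ [], listed from the bottom row upwards.  Its top
-- element z is the column that was inserted last.
Block State : Set
Block = List ℕ × ℕ
State = List Block

flat : State → List ℕ
flat []             = []
flat ((xs , z) ∷ S) = xs ++ z ∷ flat S

shape : State → List ℕ
shape = map (length ∘ proj₁)

insert : ℕ → ℕ → State → State
insert i c S = (flat (take i S) , c) ∷ drop i S

bottom : Block → ℕ
bottom ([]    , z) = z
bottom (x ∷ _ , z) = x

pop : Block → State → State
pop ([]     , z) S = S
pop (_ ∷ xs , z) S = (xs , z) ∷ S

flat-pop : ∀ B S → flat (B ∷ S) ≡ bottom B ∷ flat (pop B S)
flat-pop ([]     , z) S = refl
flat-pop (_ ∷ xs , z) S = refl

flat-split : ∀ i S → flat S ≡ flat (take i S) ++ flat (drop i S)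
flat-split zero    S              = refl
flat-split (suc i) []             = refl
flat-split (suc i) ((xs , z) ∷ S) =
  trans (cong (λ l → xs ++ z ∷ l) (flat-split i S))
        (sym (++-assoc xs (z ∷ flat (take i S)) (flat (drop i S))))

shape-insert : ∀ i c S → shape (insert i c S) ≡ size 0 i (shape S) ∷ drop i (shape S)
shape-insert i c S = cong₂ _∷_ (sym (size-flat 0 i S)) (sym (drop-map i S))
  where
  size-flat : ∀ b i S → size b i (shape S) ≡ b + length (flat (take i S))
  size-flat b zero    S              = sym (+-identityʳ b)
  size-flat b (suc i) []             = sym (+-identityʳ b)
  size-flat b (suc i) ((xs , z) ∷ S) = trans (size-flat (suc (b + length xs)) i S)
    (trans (cong suc (+-assoc b (length xs) _))
      (trans (sym (+-suc b _)) (cong (b +_)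
        (trans (sym (+-suc (length xs) _)) (sym (length-++ xs))))))

Valid-pop-shape : ∀ r q B S → Valid (north r ∷ q) (shape (B ∷ S)) → Valid q (shape (pop B S))
Valid-pop-shape r q ([]     , z) S v = v
Valid-pop-shape r q (x ∷ xs , z) S v = v

Valid-pop-shape⁻ : ∀ r q B S → Valid q (shape (pop B S)) → Valid (north r ∷ q) (shape (B ∷ S))
Valid-pop-shape⁻ r q ([]     , z) S v = v
Valid-pop-shape⁻ r q (x ∷ xs , z) S v = v

-- The columns that still have to be closed.
Active : ∀ {A : Set} → State → List (Step A) → ℕ → Set
Active S p x = x ∈ flat S ⊎ x ∈ cols p

module _ {A : Set} {p : List (Step A)} where

  insert-Active⁺ : ∀ {i c a S x} → Active S (east c a ∷ p) x → Active (insert i c S) p x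
  insert-Active⁺ {i} {c} {a} {S} (inj₁ h) =
    inj₁ (∈-insert⁺ (flat (take i S)) (subst (_ ∈_) (flat-split i S) h))
  insert-Active⁺ {i} {S = S} (inj₂ (here refl)) = inj₁ (∈-++⁺ʳ (flat (take i S)) (here refl))
  insert-Active⁺ (inj₂ (there h)) = inj₂ h

  insert-Active⁻ : ∀ {i c a S x} → Active (insert i c S) p x → Active S (east c a ∷ p) x
  insert-Active⁻ {i} {S = S} (inj₁ h) with ∈-insert⁻ (flat (take i S)) h
  ... | inj₁ e = inj₂ (here e)
  ... | inj₂ k = inj₁ (subst (_ ∈_) (sym (flat-split i S)) k)
  insert-Active⁻ (inj₂ h) = inj₂ (there h)

  pop-Active⁺ : ∀ {B S x} r → Active (B ∷ S) (north r ∷ p) x → x ≡ bottom B ⊎ Active (pop B S) p x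
  pop-Active⁺ {B} {S} r (inj₁ h) with subst (_ ∈_) (flat-pop B S) h
  ... | here e  = inj₁ e
  ... | there k = inj₂ (inj₁ k)
  pop-Active⁺ r (inj₂ h) = inj₂ (inj₂ h)

  pop-Active⁻ : ∀ {B S x} r → x ≡ bottom B ⊎ Active (pop B S) p x → Active (B ∷ S) (north r ∷ p) x
  pop-Active⁻ {B} {S} r (inj₁ e)        = inj₁ (subst (_ ∈_) (sym (flat-pop B S)) (here e))
  pop-Active⁻ {B} {S} r (inj₂ (inj₁ h)) = inj₁ (subst (_ ∈_) (sym (flat-pop B S)) (there h))
  pop-Active⁻ {B} {S} r (inj₂ (inj₂ h)) = inj₂ h

-- Higher blocks hold smaller columns, and a block with its largest column on top cannot be split
-- further, so the blocks are the skew components of `flat S`.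
Skew : State → Set
Skew []             = ⊤
Skew ((xs , z) ∷ S) = All (_< z) xs × All (λ y → All (y <_) (xs ++ z ∷ [])) (flat S) × Skew S

Skew-drop : ∀ i {S} → Skew S → Skew (drop i S)
Skew-drop zero            s           = s
Skew-drop (suc i) {[]}    s           = tt
Skew-drop (suc i) {_ ∷ S} (_ , _ , s) = Skew-drop i s

Skew-cross : ∀ i {S x y} → Skew S → x ∈ flat (take i S) → y ∈ flat (drop i S) → y < x
Skew-cross (suc i) {(xs , z) ∷ S} {x} {y} (_ , h , s) x∈ y∈
  with ∈-++⁻ (xs ++ z ∷ []) (subst (x ∈_) (sym (++-assoc xs (z ∷ []) _)) x∈)
... | inj₁ k = All.lookup (All.lookup h (subst (y ∈_) (sym (flat-split i S)) (∈-++⁺ʳ (flat (take i S)) y∈))) k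
... | inj₂ k = Skew-cross i s k y∈

Skew-insert : ∀ i {c S} → Skew S → All (_< c) (flat S) → Skew (insert i c S)
Skew-insert i {c} {S} s h =
  All.++⁻ˡ (flat (take i S)) h′ ,
  All.tabulate (λ y∈ → All.++⁺ (All.tabulate (λ x∈ → Skew-cross i s x∈ y∈))
                               (All.lookup (All.++⁻ʳ (flat (take i S)) h′) y∈ ∷ [])) ,
  Skew-drop i s
  where
  h′ = subst (All (_< c)) (flat-split i S) h

Skew-pop : ∀ B {S} → Skew (B ∷ S) → Skew (pop B S)
Skew-pop ([]     , z) (_ , _ , s)     = s
Skew-pop (x ∷ xs , z) (_ ∷ h , k , s) = h , All.map All.tail k , s

Before : ∀ {A : Set} → State → List (Step A) → Set
Before S p = All (λ x → All (x <_) (cols p)) (flat S)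

module _ {A : Set} {p : List (Step A)} where

  Before-insert : ∀ i {c a S} → All (c <_) (cols p) → Before S (east c a ∷ p) → Before (insert i c S) p
  Before-insert i {S = S} h b =
    let b′ = subst (All _) (flat-split i S) (All.map All.tail b)
    in  All.++⁺ (All.++⁻ˡ (flat (take i S)) b′) (h ∷ All.++⁻ʳ (flat (take i S)) b′)

  Before-pop : ∀ {r B S} → Before (B ∷ S) (north r ∷ p) → All (bottom B <_) (cols p) × Before (pop B S) p
  Before-pop {B = B} {S} b with subst (All _) (flat-pop B S) b
  ... | h ∷ b′ = h , b′

-- Lists of open columns go upwards, whereas row indices grow downwards.
Desc : (ℕ → ℕ) → List ℕ → Set
Desc ρ = AllPairs (λ x y → ρ y < ρ x)

-- ρ sends columns to rows and χ sends rows to columns.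
Run : (ρ χ : ℕ → ℕ) → Walk → State → Set
Run ρ χ []             []      = ⊤
Run ρ χ []             (_ ∷ _) = ⊥
Run ρ χ (east c i ∷ q) S       = i ≤ length S × Desc ρ (flat (insert i c S)) × Run ρ χ q (insert i c S)
Run ρ χ (north r ∷ q)  []      = ⊥
Run ρ χ (north r ∷ q)  (B ∷ S) = ρ (bottom B) ≡ r × χ r ≡ bottom B × Run ρ χ q (pop B S)

Run⇒Valid : ∀ {ρ χ} q S → Run ρ χ q S → Valid q (shape S)
Run⇒Valid []             []      _           = tt
Run⇒Valid (east c i ∷ q) S       (h , _ , w) =
  subst (i ≤_) (sym (length-map _ S)) h ,
  subst (Valid q) (shape-insert i c S) (Run⇒Valid q _ w)
Run⇒Valid (north r ∷ q)  (B ∷ S) (_ , _ , w) = Valid-pop-shape⁻ r q B S (Run⇒Valid q _ w)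

-- Every active column is closed by a later north step, which records it in both maps. Together with
-- `Run-χ`, a run makes `ρ` and `χ` mutually inverse between the active columns and the remaining
-- rows.
Run-ρ : ∀ {ρ χ} q S → Run ρ χ q S → ∀ {x} → Active S q x → ρ x ∈ rows q × χ (ρ x) ≡ x
Run-ρ []          []      _           (inj₁ ())
Run-ρ []          []      _           (inj₂ ())
Run-ρ (east c i ∷ q) S       (_ , _ , w) a = Run-ρ q _ w (insert-Active⁺ {p = q} {i} {c} {i} {S} a)
Run-ρ (north r ∷ q)   (B ∷ S) (refl , e , w) a with pop-Active⁺ {p = q} {B} {S} r a
... | inj₁ refl = here refl , e
... | inj₂ a′   = map₁ there (Run-ρ q _ w a′)

Run-χ : ∀ {ρ χ} q S → Run ρ χ q S → ∀ {r} → r ∈ rows q → Active S q (χ r) × ρ (χ r) ≡ r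
Run-χ (east c i ∷ q) S       (_ , _ , w) r∈ = map₁ (insert-Active⁻ {p = q} {i} {c} {i} {S}) (Run-χ q _ w r∈)
Run-χ {ρ} (north r ∷ q)   (B ∷ S) (d , e , w) (here refl) = pop-Active⁻ {p = q} {B} {S} r (inj₁ e) , trans (cong ρ e) d
Run-χ (north r ∷ q)   (B ∷ S) (d , e , w) (there r∈)  =
  map₁ (pop-Active⁻ {p = q} {B} {S} r ∘ inj₂) (Run-χ q _ w r∈)

Run-below : ∀ {Y ρ χ} q S → Sorted Y q → Run ρ χ q S → ∀ {c} → c ∈ cols q → Y (ρ c) c
Run-below (east c i ∷ q) S       (_ , k , s) (_ , _ , w) (here refl) =
  All.lookup k (proj₁ (Run-ρ q _ w (insert-Active⁺ {p = q} {i} {c} {i} {S} (inj₂ (here refl)))))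
Run-below (east c i ∷ q) S       (_ , _ , s) (_ , _ , w) (there h)   = Run-below q _ s w h
Run-below (north r ∷ q)  (B ∷ S) (_ , _ , s) (_ , _ , w) h           = Run-below q _ s w h

Desc-cong : ∀ {ρ ρ′} l → (∀ {x} → x ∈ l → ρ x ≡ ρ′ x) → Desc ρ l → Desc ρ′ l
Desc-cong []      h []       = []
Desc-cong {ρ} {ρ′} (x ∷ l) h (p ∷ ps) =
  All.tabulate (λ {y} y∈ → subst₂ _<_ (h (there y∈)) (h (here refl)) (All.lookup p y∈)) ∷
  Desc-cong l (λ y∈ → h (there y∈)) ps

Run-cong : ∀ {ρ χ ρ′ χ′} q S → (∀ {x} → Active S q x → ρ x ≡ ρ′ x) → (∀ {r} → r ∈ rows q → χ r ≡ χ′ r) →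
           Run ρ χ q S → Run ρ′ χ′ q S
Run-cong []          []      _ _ _ = tt
Run-cong {ρ} {_} {ρ′} (east c i ∷ q) S h k (i≤ , d , w) =
  i≤ , Desc-cong (flat (insert i c S)) (λ x∈ → h′ (inj₁ x∈)) d , Run-cong q _ h′ k w
  where
  h′ : ∀ {x} → Active (insert i c S) q x → ρ x ≡ ρ′ x
  h′ a = h (insert-Active⁻ {p = q} {i} {c} {i} {S} a)
Run-cong (north r ∷ q)   (B ∷ S) h k (d , e , w) =
  trans (sym (h (pop-Active⁻ {p = q} {B} {S} r (inj₁ refl)))) d , trans (sym (k (here refl))) e ,
  Run-cong q _ (λ a → h (pop-Active⁻ {p = q} {B} {S} r (inj₂ a))) (λ r∈ → k (there r∈)) w

-- The labels determine the list of open columns at every moment, hence the column closed by each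
-- north step; the step itself names the row.
Run-deterministic : ∀ {ρ χ ρ′ χ′} q S → Run ρ χ q S → Run ρ′ χ′ q S →
                    (∀ {x} → Active S q x → ρ x ≡ ρ′ x) × (∀ {r} → r ∈ rows q → χ r ≡ χ′ r)
Run-deterministic [] [] _ _ = (λ { (inj₁ ()) ; (inj₂ ()) }) , λ ()
Run-deterministic (east c i ∷ q) S (_ , _ , w) (_ , _ , w′) =
  map₁ (λ f {x} a → f (insert-Active⁺ {p = q} {i} {c} {i} {S} a)) (Run-deterministic q _ w w′)
Run-deterministic {ρ} {χ} {ρ′} {χ′} (north r ∷ q) (B ∷ S) (d , e , w) (d′ , e′ , w′) =
  (λ a → on-active (pop-Active⁺ {p = q} {B} {S} r a)) , on-row
  where
  on-active : ∀ {x} → x ≡ bottom B ⊎ Active (pop B S) q x → ρ x ≡ ρ′ x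
  on-active (inj₁ refl) = trans d (sym d′)
  on-active (inj₂ a)    = proj₁ (Run-deterministic q _ w w′) a
  on-row : ∀ {t} → t ∈ r ∷ rows q → χ t ≡ χ′ t
  on-row (here refl) = trans e (sym e′)
  on-row (there t∈)  = proj₂ (Run-deterministic q _ w w′) t∈

-- Only the top z of a block needs to be compared: as z is the largest column of its
-- block, inserting c below z but above another element would create a 132.
slot : (ℕ → ℕ) → ℕ → State → ℕ
slot ρ c []             = 0
slot ρ c ((xs , z) ∷ S) with ρ c <? ρ z
... | yes _ = suc (slot ρ c S)
... | no  _ = 0

-- By `Desc`, the tops of the merged blocks lie below `c` and the top of the first remaining block
-- lies above it, so `slot` stops exactly there.
slot-unique : ∀ {ρ c} i S → i ≤ length S → Desc ρ (flat (insert i c S)) → i ≡ slot ρ c S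
slot-unique zero [] _ _ = refl
slot-unique {ρ} {c} zero ((xs , z) ∷ S) _ (h ∷ _) with ρ c <? ρ z
... | yes c<z = contradiction (All.lookup h (∈-++⁺ʳ xs (here refl))) (<-asym c<z)
... | no  _   = refl
slot-unique {ρ} {c} (suc i) ((xs , z) ∷ S) (s≤s i≤) d
  with AllPairs-++⁻ xs (subst (Desc ρ) (++-assoc xs (z ∷ flat (take i S)) (c ∷ flat (drop i S))) d)
... | _ , (h ∷ d′) , _ with ρ c <? ρ z
...   | yes _  = cong suc (slot-unique i S i≤ d′)
...   | no c≮z = contradiction (All.lookup h (∈-++⁺ʳ (flat (take i S)) (here refl))) c≮z

Run-unique : ∀ {ρ χ} q q′ S → erase q ≡ erase q′ → Run ρ χ q S → Run ρ χ q′ S → q ≡ q′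
Run-unique []          []           S  _ _ _ = refl
Run-unique []          (east _ _ ∷ _)  S  ()
Run-unique []          (north _ ∷ _)    S  ()
Run-unique (east c i ∷ q) (east c′ j ∷ q′) S e (i≤ , d , w) (j≤ , d′ , w′) with erase-E e
  where
  erase-E : ∀ {c c′} {q q′ : Path} → east c tt ∷ q ≡ east c′ tt ∷ q′ → c ≡ c′ × q ≡ q′
  erase-E refl = refl , refl
... | refl , e′ with trans (slot-unique i S i≤ d) (sym (slot-unique j S j≤ d′))
...   | refl = cong (east c i ∷_) (Run-unique q q′ _ e′ w w′)
Run-unique (north r ∷ q)   (north r′ ∷ q′) (B ∷ S) e (_ , _ , w) (_ , _ , w′) with erase-N e
  where
  erase-N : ∀ {r r′} {q q′ : Path} → north r ∷ q ≡ north r′ ∷ q′ → r ≡ r′ × q ≡ q′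
  erase-N refl = refl , refl
... | refl , e′ = cong (north r ∷_) (Run-unique q q′ _ e′ w w′)

-- Suppose `x`, `y`, `c` form a 132. If both `x` and `y` are open when `c` is inserted, then `x`,
-- being below `c`, is in a merged block and `y` in a remaining one, so `y < x` by `Skew-cross`. If
-- `x` is closed earlier, its row does not reach column `c`; and `y` cannot be closed before `x`, as
-- rows are closed from the bottom.
Run-avoids : ∀ {Y ρ χ} q S → Sorted Y q → Skew S → Before S q → Run ρ χ q S →
             ∀ {x y c} → Active S q x → Active S q y → c ∈ cols q → x < y → y < c →
             ρ y < ρ c → ρ c < ρ x → ¬ Y (ρ x) c
Run-avoids {Y} {ρ} (east c i ∷ q) S (h , k , s) sk b (_ , d , w) {x} {y} ax ay (here refl) x<y y<c ρy<ρc ρc<ρx _ =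
  <-asym x<y (Skew-cross i sk (x∈take (split ax (<-trans x<y y<c))) (y∈drop (split ay y<c)))
  where
  F₁ = flat (take i S)
  pieces = AllPairs-remove F₁ d
  split : ∀ {x} → Active S (east c i ∷ q) x → x < c → x ∈ F₁ ⊎ x ∈ flat (drop i S)
  split (inj₁ x∈)          _   = ∈-++⁻ F₁ (subst (_ ∈_) (flat-split i S) x∈)
  split (inj₂ (here refl)) x<c = contradiction x<c (<-irrefl refl)
  split (inj₂ (there x∈))  x<c = contradiction x<c (<-asym (All.lookup h x∈))
  x∈take : x ∈ F₁ ⊎ x ∈ flat (drop i S) → x ∈ F₁
  x∈take (inj₁ x∈) = x∈
  x∈take (inj₂ x∈) = contradiction ρc<ρx (<-asym (All.lookup (proj₂ (proj₂ pieces)) x∈))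
  y∈drop : y ∈ F₁ ⊎ y ∈ flat (drop i S) → y ∈ flat (drop i S)
  y∈drop (inj₁ y∈) = contradiction ρy<ρc (<-asym (All.lookup (proj₁ (proj₂ pieces)) y∈))
  y∈drop (inj₂ y∈) = y∈
Run-avoids (east c i ∷ q) S (h , k , s) sk b (_ , d , w) ax ay (there c∈) =
  Run-avoids q _ s (Skew-insert i sk (All.map All.head b)) (Before-insert {p = q} i {c} {i} {S} h b) w
    (insert-Active⁺ {p = q} {i} {c} {i} {S} ax) (insert-Active⁺ {p = q} {i} {c} {i} {S} ay) c∈
Run-avoids {Y} {ρ} (north r ∷ q) (B ∷ S) (h , k , s) sk b (e , _ , w) ax ay c∈ x<y y<c ρy<ρc ρc<ρx yes-Y
  with pop-Active⁺ {p = q} {B} {S} r ax | pop-Active⁺ {p = q} {B} {S} r ay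
... | inj₁ refl | _         = All.lookup k c∈ (subst (λ r → Y r _) e yes-Y)
... | inj₂ ax′  | inj₁ refl = <-asym (<-trans ρy<ρc ρc<ρx)
                                (subst (_ <_) (sym e) (All.lookup h (proj₁ (Run-ρ q _ w ax′))))
... | inj₂ ax′  | inj₂ ay′  = Run-avoids q _ s (Skew-pop B sk) (proj₂ (Before-pop {p = q} {r} {B} {S} b)) w
                                ax′ ay′ c∈ x<y y<c ρy<ρc ρc<ρx yes-Y

-- 132-avoiding placements and walks

-- Avoidance is applied only inside the block at which `slot` stops; the blocks before and after it
-- are placed by `Desc`.
slot-splits : ∀ {ρ c} S → Skew S → Desc ρ (flat S) → (∀ {x} → x ∈ flat S → ρ x ≢ ρ c) →
              (∀ {x y} → x ∈ flat S → y ∈ flat S → x < y → ρ y < ρ c → ¬ ρ c < ρ x) →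
              slot ρ c S ≤ length S ×
              All (λ x → ρ c < ρ x) (flat (take (slot ρ c S) S)) ×
              All (λ x → ρ x < ρ c) (flat (drop (slot ρ c S) S))
slot-splits [] _ _ _ _ = z≤n , [] , []
slot-splits {ρ} {c} ((xs , z) ∷ S) (xs<z , _ , sk) d ne av
  with AllPairs-++⁻ xs d
... | _ , (z> ∷ d′) , cross with ρ c <? ρ z
...   | yes c<z with slot-splits S sk d′ (λ x∈ → ne (∈-++⁺ʳ xs (there x∈)))
                     (λ x∈ y∈ → av (∈-++⁺ʳ xs (there x∈)) (∈-++⁺ʳ xs (there y∈)))
...     | i≤ , above , below =
  s≤s i≤ , All.++⁺ (All.map (λ h → <-trans c<z (All.head h)) cross) (c<z ∷ above) , below
slot-splits {ρ} {c} ((xs , z) ∷ S) (xs<z , _ , sk) d ne av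
      | _ , (z> ∷ d′) , cross | no c≮z =
  z≤n , [] , All.++⁺ (All.tabulate xs-below) (z<c ∷ All.map (λ h → <-trans h z<c) z>)
  where
  z<c : ρ z < ρ c
  z<c = ≤∧≢⇒< (≮⇒≥ c≮z) (ne (∈-++⁺ʳ xs (here refl)))
  xs-below : ∀ {x} → x ∈ xs → ρ x < ρ c
  xs-below {x} x∈ with <-cmp (ρ x) (ρ c)
  ... | tri< lt _ _ = lt
  ... | tri≈ _ e _  = contradiction e (ne (∈-++⁺ˡ x∈))
  ... | tri> _ _ gt =
    contradiction gt (av (∈-++⁺ˡ x∈) (∈-++⁺ʳ xs (here refl)) (All.lookup xs<z x∈) z<c)

-- The labels are the values of `slot`, and `slot-splits` shows that the list stays sorted by rows.
-- At a north step the bijectivity of the placement identifies the column to be closed as the bottom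
-- one.
encode : ∀ {Y ρ χ} p S → Sorted Y p → Skew S → Before S p → Desc ρ (flat S) →
         (∀ {x} → Active S p x → ρ x ∈ rows p × χ (ρ x) ≡ x) →
         (∀ {r} → r ∈ rows p → Active S p (χ r) × ρ (χ r) ≡ r) →
         (∀ {c} → c ∈ cols p → Y (ρ c) c) →
         (∀ {x y c} → Active S p x → Active S p y → c ∈ cols p → x < y → y < c →
            ρ y < ρ c → ρ c < ρ x → ¬ Y (ρ x) c) →
         ∃[ q ] erase q ≡ p × Run ρ χ q S
encode [] [] _ _ _ _ _ _ _ _ = [] , refl , tt
encode [] ((xs , z) ∷ S) _ _ _ _ onρ _ _ _ with onρ {z} (inj₁ (∈-++⁺ʳ xs (here refl)))
... | () , _
encode {Y} {ρ} {χ} (east c tt ∷ p) S (h , k , s) sk b d onρ onχ below avoid =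
  east c i ∷ q , cong (east c tt ∷_) e , i≤ , d′ , w
  where
  i = slot ρ c S
  act⁺ : ∀ {x} → Active S (east c tt ∷ p) x → Active (insert i c S) p x
  act⁺ = insert-Active⁺ {p = p} {i} {c} {tt} {S}
  act⁻ : ∀ {x} → Active (insert i c S) p x → Active S (east c tt ∷ p) x
  act⁻ = insert-Active⁻ {p = p} {i} {c} {tt} {S}
  before-c : ∀ {x} → x ∈ flat S → x < c
  before-c x∈ = All.head (All.lookup b x∈)
  distinct : ∀ {x} → x ∈ flat S → ρ x ≢ ρ c
  distinct x∈ eq = <⇒≢ (before-c x∈)
    (trans (sym (proj₂ (onρ (inj₁ x∈)))) (trans (cong χ eq) (proj₂ (onρ (inj₂ (here refl))))))
  splits = slot-splits S sk d distinct
    (λ x∈ y∈ x<y ρy ρx → avoid (inj₁ x∈) (inj₁ y∈) (here refl) x<y (before-c y∈) ρy ρx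
                               (All.lookup k (proj₁ (onρ (inj₁ x∈)))))
  i≤ = proj₁ splits
  d′ : Desc ρ (flat (insert i c S))
  d′ = AllPairs-insert (flat (take i S)) (subst (Desc ρ) (flat-split i S) d)
         (proj₁ (proj₂ splits)) (proj₂ (proj₂ splits))
  rest = encode p (insert i c S) s (Skew-insert i sk (All.map All.head b))
           (Before-insert {p = p} i {c} {tt} {S} h b) d′
           (λ a → onρ (act⁻ a)) (λ r∈ → map₁ act⁺ (onχ r∈)) (λ c∈ → below (there c∈))
           (λ ax ay c∈ → avoid (act⁻ ax) (act⁻ ay) (there c∈))
  q = proj₁ rest
  e = proj₁ (proj₂ rest)
  w = proj₂ (proj₂ rest)
encode {Y} {ρ} {χ} (north r ∷ p)   S (h , k , s) sk b d onρ onχ below avoid = body S sk b d onρ onχ avoid χr∈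
  where
  -- The columns still to come do not meet row `r`, so the column of row `r` is already open.
  χr∈ : χ r ∈ flat S
  χr∈ with onχ (here refl)
  ... | inj₁ x∈ , _ = x∈
  ... | inj₂ x∈ , e = contradiction (subst (λ t → Y t (χ r)) e (below x∈)) (All.lookup k x∈)
  -- `S` is abstracted, together with the facts about it, in order to be split; `χr∈` excludes the
  -- empty list.
  body : ∀ S → Skew S → Before S (north r ∷ p) → Desc ρ (flat S) →
         (∀ {x} → Active S (north r ∷ p) x → ρ x ∈ r ∷ rows p × χ (ρ x) ≡ x) →
         (∀ {t} → t ∈ r ∷ rows p → Active S (north r ∷ p) (χ t) × ρ (χ t) ≡ t) →
         (∀ {x y c} → Active S (north r ∷ p) x → Active S (north r ∷ p) y → c ∈ cols p → x < y → y < c →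
            ρ y < ρ c → ρ c < ρ x → ¬ Y (ρ x) c) →
         χ r ∈ flat S → ∃[ q ] erase q ≡ north r ∷ p × Run ρ χ q S
  body (B ∷ S) sk b d onρ onχ avoid x∈ with subst (Desc ρ) (flat-pop B S) d
  ... | hd ∷ d′ = north r ∷ q , cong (north r ∷_) e , trans (cong ρ (sym bot)) (proj₂ (onχ (here refl))) , bot , w
    where
    pop⁺ : ∀ {x} → Active (B ∷ S) (north r ∷ p) x → x ≡ bottom B ⊎ Active (pop B S) p x
    pop⁺ = pop-Active⁺ {p = p} {B} {S} r
    pop⁻ : ∀ {x} → Active (pop B S) p x → Active (B ∷ S) (north r ∷ p) x
    pop⁻ a = pop-Active⁻ {p = p} {B} {S} r (inj₂ a)
    -- Otherwise `χ r` would lie strictly above the bottom column, whose row would then exceed `r`;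
    -- but `r` is the largest remaining row.
    bot : χ r ≡ bottom B
    bot with subst (χ r ∈_) (flat-pop B S) x∈
    ... | here eq  = eq
    ... | there k∈ with proj₁ (onρ {bottom B} (pop-Active⁻ {p = p} {B} {S} r (inj₁ refl)))
                      | subst (_< ρ (bottom B)) (proj₂ (onχ (here refl))) (All.lookup hd k∈)
    ...   | here eq  | lt = contradiction lt (<-irrefl (sym eq))
    ...   | there m  | lt = contradiction lt (<-asym (All.lookup h m))
    still : ∀ {x} → Active (pop B S) p x → ρ x ∈ rows p × χ (ρ x) ≡ x
    still {x} a with onρ (pop⁻ a)
    ... | there m , eq  = m , eq
    ... | here m  , eq with a
    ...   | inj₁ x∈′ = contradiction (All.lookup hd x∈′) (<-irrefl (cong ρ (trans (sym eq) (trans (cong χ m) bot))))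
    ...   | inj₂ x∈′ = contradiction (subst (λ t → Y t x) m (below x∈′)) (All.lookup k x∈′)
    open-col : ∀ {t} → t ∈ rows p → Active (pop B S) p (χ t) × ρ (χ t) ≡ t
    open-col {t} t∈ with onχ (there t∈)
    ... | a , eq with pop⁺ a
    ...   | inj₂ a′ = a′ , eq
    ...   | inj₁ eq′ = contradiction (All.lookup h t∈)
                         (<-irrefl (trans (sym eq) (trans (cong ρ (trans eq′ (sym bot))) (proj₂ (onχ (here refl))))))
    rest = encode p (pop B S) s (Skew-pop B sk) (proj₂ (Before-pop {p = p} {r} {B} {S} b)) d′ still open-col below
             (λ ax ay → avoid (pop⁻ ax) (pop⁻ ay))
    q = proj₁ rest
    e = proj₁ (proj₂ rest)
    w = proj₂ (proj₂ rest)

update : (ℕ → ℕ) → ℕ → ℕ → ℕ → ℕ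
update f a b x with x ≟ a
... | yes _ = b
... | no  _ = f x

update-same : ∀ f a b → update f a b a ≡ b
update-same f a b with a ≟ a
... | yes _ = refl
... | no ne = contradiction refl ne

update-other : ∀ f {a} b {x} → x ≢ a → update f a b x ≡ f x
update-other f {a} b {x} ne with x ≟ a
... | yes e = contradiction e ne
... | no _  = refl

-- The maps are built from the end of the walk, each north step overwriting one value of each, so
-- away from the path `ρ₀` and `χ₀` persist. Distinctness of the open columns protects the earlier
-- values. As later rows are smaller than `r`, the bottom column gets the lowest row, which gives
-- `Desc`.
decode : ∀ {Y} (ρ₀ χ₀ : ℕ → ℕ) q S → Valid q (shape S) → Sorted Y q → AllPairs _≢_ (flat S) → Before S q →
         ∃₂ λ ρ χ → Run ρ χ q S × Desc ρ (flat S) ×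
                    (∀ {x} → ¬ Active S q x → ρ x ≡ ρ₀ x) × (∀ {r} → r ∉ rows q → χ r ≡ χ₀ r)
decode ρ₀ χ₀ [] [] _ _ _ _ = ρ₀ , χ₀ , tt , [] , (λ _ → refl) , (λ _ → refl)
decode ρ₀ χ₀ (east c i ∷ q) S (i≤ , v) (h , k , s) u b
  with decode ρ₀ χ₀ q (insert i c S) (subst (Valid q) (sym (shape-insert i c S)) v) s
         (AllPairs-insert (flat (take i S)) (subst (AllPairs _≢_) (flat-split i S) u)
           (All.map (λ lt → <⇒≢ lt) (All.++⁻ˡ (flat (take i S)) before))
           (All.map (λ lt → ≢-sym (<⇒≢ lt)) (All.++⁻ʳ (flat (take i S)) before)))
         (Before-insert {p = q} i {c} {i} {S} h b)
  where
  before = subst (All (_< c)) (flat-split i S) (All.map All.head b)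
... | ρ , χ , w , d , outρ , outχ =
  ρ , χ , (subst (i ≤_) (length-map _ S) i≤ , d , w) ,
  subst (Desc ρ) (sym (flat-split i S)) (proj₁ (AllPairs-remove (flat (take i S)) d)) ,
  (λ na → outρ (λ a → na (insert-Active⁻ {p = q} {i} {c} {i} {S} a))) , outχ
decode ρ₀ χ₀ (north r ∷ q) (B ∷ S) v (h , k , s) u b
  with subst (AllPairs _≢_) (flat-pop B S) u | Before-pop {p = q} {r} {B} {S} b
... | fresh ∷ u′ | b₀ , b′
  with decode ρ₀ χ₀ q (pop B S) (Valid-pop-shape r q B S v) s u′ b′
... | ρ′ , χ′ , w , d , outρ , outχ =
  ρ , χ , (update-same ρ′ x r , update-same χ′ r x , Run-cong q (pop B S) sameρ sameχ w) ,
  subst (Desc ρ) (sym (flat-pop B S))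
    (All.tabulate (λ y∈ → subst₂ _<_ (sameρ (inj₁ y∈)) (sym (update-same ρ′ x r))
                            (All.lookup h (proj₁ (Run-ρ q (pop B S) w (inj₁ y∈)))))
     ∷ Desc-cong (flat (pop B S)) (λ y∈ → sameρ (inj₁ y∈)) d) ,
  (λ na → trans (update-other ρ′ r (λ e → na (pop-Active⁻ {p = q} {B} {S} r (inj₁ e))))
                (outρ (λ a → na (pop-Active⁻ {p = q} {B} {S} r (inj₂ a))))) ,
  (λ t∉ → trans (update-other χ′ x (λ e → t∉ (here e))) (outχ (λ t∈ → t∉ (there t∈))))
  where
  x = bottom B
  ρ = update ρ′ x r
  χ = update χ′ r x
  not-bottom : ∀ {y} → Active (pop B S) q y → y ≢ x
  not-bottom (inj₁ y∈) e = All.lookup fresh y∈ (sym e)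
  not-bottom (inj₂ y∈) e = <⇒≢ (All.lookup b₀ y∈) (sym e)
  sameρ : ∀ {y} → Active (pop B S) q y → ρ′ y ≡ ρ y
  sameρ a = sym (update-other ρ′ r (not-bottom a))
  sameχ : ∀ {t} → t ∈ rows q → χ′ t ≡ χ t
  sameχ t∈ = sym (update-other χ′ x (<⇒≢ (All.lookup h t∈)))

-- The exchange of 132-avoiding and 213-avoiding placements

record Placement (Y : Board) (p : Path) (ρ χ : ℕ → ℕ) : Set where
  field
    ρ∈    : ∀ {c} → c ∈ cols p → ρ c ∈ rows p
    χρ    : ∀ {c} → c ∈ cols p → χ (ρ c) ≡ c
    χ∈    : ∀ {r} → r ∈ rows p → χ r ∈ cols p
    ρχ    : ∀ {r} → r ∈ rows p → ρ (χ r) ≡ r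
    below : ∀ {c} → c ∈ cols p → Y (ρ c) c

open Placement

-- In a 132 the first one is the lowest and the third is in the last column, so on a down-closed
-- board the cell in row `ρ x` and column `c` decides whether the whole pattern lies inside.
No132 : Board → Path → (ℕ → ℕ) → Set
No132 Y p ρ = ∀ {x y c} → x ∈ cols p → y ∈ cols p → c ∈ cols p → x < y → y < c →
              ρ y < ρ c → ρ c < ρ x → ¬ Y (ρ x) c

∈-cols-turn⁻ : ∀ p {x} → x ∈ cols (turn p) → x ∈ rows p
∈-cols-turn⁻ p x∈ = subst (λ p → _ ∈ rows p) (turn-involutive p) (∈-rows-turn (turn p) x∈)

∈-rows-turn⁻ : ∀ p {x} → x ∈ rows (turn p) → x ∈ cols p
∈-rows-turn⁻ p x∈ = subst (λ p → _ ∈ cols p) (turn-involutive p) (∈-cols-turn (turn p) x∈)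

Placement-turn : ∀ {Y p ρ χ} → Placement Y p ρ χ → Placement (flip Y) (turn p) χ ρ
Placement-turn {Y} {p} {ρ} {χ} P = record
  { ρ∈    = λ x → ∈-rows-turn p (χ∈ P (∈-cols-turn⁻ p x))
  ; χρ    = λ x → ρχ P (∈-cols-turn⁻ p x)
  ; χ∈    = λ x → ∈-cols-turn p (ρ∈ P (∈-rows-turn⁻ p x))
  ; ρχ    = λ x → χρ P (∈-rows-turn⁻ p x)
  ; below = λ x → subst (λ r → Y r _) (ρχ P (∈-cols-turn⁻ p x)) (below P (χ∈ P (∈-cols-turn⁻ p x)))
  }

-- The primed side avoids 213, hence is read with rows and columns exchanged.
Matched : Path → (ρ χ ρ′ χ′ : ℕ → ℕ) → Set
Matched p ρ χ ρ′ χ′ = ∃[ q ] erase q ≡ p × Run ρ χ q [] × Run χ′ ρ′ (reflect q) []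

-- Since `reflect` is an involution on valid walks, the relation is symmetric up to transposition;
-- this reduces each backward statement to a forward one.
Matched-turn : ∀ {p ρ χ ρ′ χ′} → Matched p ρ χ ρ′ χ′ → Matched (turn p) χ′ ρ′ χ ρ
Matched-turn {ρ = ρ} {χ} (q , e , w , w′) =
  reflect q , trans (erase-reflect q) (cong turn e) , w′ ,
  subst (λ q → Run ρ χ q []) (sym (reflect-involutive {q} (Run⇒Valid q [] w))) w

Agree : List ℕ → (f g : ℕ → ℕ) → Set
Agree l f g = ∀ {x} → x ∈ l → f x ≡ g x

-- The placement determines its walk by `Run-unique`, and the reflected walk determines the other
-- placement by `Run-deterministic`.
Matched-functional : ∀ {p ρ₁ χ₁ ρ₁′ χ₁′ ρ₂ χ₂ ρ₂′ χ₂′} → Agree (cols p) ρ₁ ρ₂ → Agree (rows p) χ₁ χ₂ →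
  Matched p ρ₁ χ₁ ρ₁′ χ₁′ → Matched p ρ₂ χ₂ ρ₂′ χ₂′ → Agree (cols p) ρ₁′ ρ₂′ × Agree (rows p) χ₁′ χ₂′
Matched-functional {ρ₂ = ρ₂} {χ₂} eρ eχ (q , refl , w₁ , w₁′) (q₂ , e , w₂ , w₂′)
  with Run-unique q q₂ [] (sym e) (Run-cong q [] onρ onχ w₁) w₂
  where
  onρ : ∀ {x} → Active [] q x → _
  onρ (inj₂ x∈) = eρ (subst (_ ∈_) (sym (cols-erase q)) x∈)
  onχ : ∀ {x} → x ∈ rows q → _
  onχ x∈ = eχ (subst (_ ∈_) (sym (rows-erase q)) x∈)
... | refl with Run-deterministic (reflect q) [] w₁′ w₂′
... | fχ , fρ =
  (λ {x} x∈ → fρ (subst (x ∈_) (rows-erase (reflect q))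
               (subst (λ p → x ∈ rows p) (sym (erase-reflect q)) (∈-rows-turn (erase q) x∈)))) ,
  (λ {x} x∈ → fχ (inj₂ (subst (x ∈_) (cols-erase (reflect q))
               (subst (λ p → x ∈ cols p) (sym (erase-reflect q)) (∈-cols-turn (erase q) x∈)))))

Run⇒Placement : ∀ {Y ρ χ} q → Sorted Y q → Run ρ χ q [] → Placement Y (erase q) ρ χ
Run⇒Placement {Y} {ρ} {χ} q s w = record
  { ρ∈    = λ c∈ → subst (_ ∈_) (sym (rows-erase q)) (proj₁ (onρ c∈))
  ; χρ    = λ c∈ → proj₂ (onρ c∈)
  ; χ∈    = λ r∈ → subst (_ ∈_) (sym (cols-erase q)) (active-col (proj₁ (onχ r∈)))
  ; ρχ    = λ r∈ → proj₂ (onχ r∈)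
  ; below = λ c∈ → Run-below q [] s w (subst (_ ∈_) (cols-erase q) c∈)
  }
  where
  onρ : ∀ {x} → x ∈ cols (erase q) → ρ x ∈ rows q × χ (ρ x) ≡ x
  onρ x∈ = Run-ρ q [] w (inj₂ (subst (_ ∈_) (cols-erase q) x∈))
  onχ : ∀ {r} → r ∈ rows (erase q) → Active [] q (χ r) × ρ (χ r) ≡ r
  onχ r∈ = Run-χ q [] w (subst (_ ∈_) (rows-erase q) r∈)
  active-col : ∀ {x} → Active [] q x → x ∈ cols q
  active-col (inj₂ x∈) = x∈

Sorted-reflect : ∀ {Y} q → Sorted Y (erase q) → Sorted (flip Y) (reflect q)
Sorted-reflect {Y} q s = Sorted-erase (flip Y) (reflect q)
  (subst (Sorted (flip Y)) (sym (erase-reflect q)) (Sorted-turn (erase q) s))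

exchange : ∀ {Y p ρ χ} → Sorted Y p → Placement Y p ρ χ → No132 Y p ρ →
  ∃₂ λ ρ′ χ′ → Matched p ρ χ ρ′ χ′ × Placement Y p ρ′ χ′ × No132 (flip Y) (turn p) χ′ ×
               (∀ {c} → c ∉ cols p → ρ′ c ≡ ρ c) × (∀ {r} → r ∉ rows p → χ′ r ≡ χ r)
exchange {Y} {p} {ρ} {χ} s P av
  with encode p [] s tt [] [] (λ { (inj₂ x∈) → ρ∈ P x∈ , χρ P x∈ })
         (λ r∈ → inj₂ (χ∈ P r∈) , ρχ P r∈) (below P)
         (λ { (inj₂ x∈) (inj₂ y∈) → av x∈ y∈ })
... | q , refl , w
  -- The old maps, in exchanged roles, are the defaults, so that nothing changes outside the path.
  with decode χ ρ (reflect q) [] (reflect-Valid {q} (Run⇒Valid q [] w)) (Sorted-reflect q s) [] []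
... | χ′ , ρ′ , w′ , _ , outχ , outρ =
  ρ′ , χ′ , (q , refl , w , w′) ,
  subst (λ p → Placement Y p ρ′ χ′) (turn-involutive p)
    (Placement-turn (subst (λ p → Placement (flip Y) p χ′ ρ′) (erase-reflect q)
      (Run⇒Placement (reflect q) s′ w′))) ,
  (λ {x} {y} {c} x∈ y∈ c∈ → Run-avoids (reflect q) [] s′ tt [] w′
     (inj₂ (active-col x∈)) (inj₂ (active-col y∈)) (active-col c∈)) ,
  (λ c∉ → outρ (λ c∈ → c∉ (∈-rows-turn⁻ p (subst (λ p → _ ∈ rows p) (erase-reflect q)
     (subst (_ ∈_) (sym (rows-erase (reflect q))) c∈))))) ,
  (λ r∉ → outχ (λ { (inj₂ r∈) → r∉ (∈-cols-turn⁻ p (subst (λ p → _ ∈ cols p) (erase-reflect q)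
     (subst (_ ∈_) (sym (cols-erase (reflect q))) r∈))) }))
  where
  s′ = Sorted-reflect q s
  active-col : ∀ {x} → x ∈ cols (turn (erase q)) → x ∈ cols (reflect q)
  active-col {x} x∈ = subst (x ∈_) (cols-erase (reflect q)) (subst (λ p → x ∈ cols p) (sym (erase-reflect q)) x∈)

-- A 213 of `ρ′` is a 132 of `χ′` on the transposed board, so `exchange` applies there and its
-- result is turned back.
exchange⁻ : ∀ {Y p ρ′ χ′} → Sorted Y p → Placement Y p ρ′ χ′ → No132 (flip Y) (turn p) χ′ →
  ∃₂ λ ρ χ → Matched p ρ χ ρ′ χ′ × Placement Y p ρ χ × No132 Y p ρ ×
             (∀ {c} → c ∉ cols p → ρ c ≡ ρ′ c) × (∀ {r} → r ∉ rows p → χ r ≡ χ′ r)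
exchange⁻ {Y} {p} {ρ′} {χ′} s P av with exchange (Sorted-turn p s) (Placement-turn P) av
... | χ , ρ , m , P′ , av′ , outχ , outρ =
  ρ , χ , subst (λ p → Matched p ρ χ ρ′ χ′) (turn-involutive p) (Matched-turn m) ,
  subst (λ p → Placement Y p ρ χ) (turn-involutive p) (Placement-turn P′) ,
  subst (λ p → No132 Y p ρ) (turn-involutive p) (λ {x} {y} {c} → av′ {x} {y} {c}) ,
  (λ c∉ → outρ (λ c∈ → c∉ (∈-rows-turn⁻ p c∈))) ,
  (λ r∉ → outχ (λ r∈ → r∉ (∈-cols-turn⁻ p r∈)))

-- Pattern containment in coordinates

module _ (A B : Setoid 0ℓ 0ℓ) where
  open Setoid A using () renaming (Carrier to ∣A∣; _≈_ to _≈₁_)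
  open Setoid B using () renaming (Carrier to ∣B∣; _≈_ to _≈₂_)

  -- The maps involve choices of representatives. Functionality of the relation in both directions
  -- yields congruence and both inverse laws without computing the maps.
  correspondence⇒inverse : (_~_ : ∣A∣ → ∣B∣ → Set) →
    (∀ a → ∃[ b ] a ~ b) → (∀ b → ∃[ a ] a ~ b) →
    (∀ {a a′ b b′} → a ≈₁ a′ → a ~ b → a′ ~ b′ → b ≈₂ b′) →
    (∀ {a a′ b b′} → b ≈₂ b′ → a ~ b → a′ ~ b′ → a ≈₁ a′) → Inverse A B
  correspondence⇒inverse _~_ fwd bwd functional injective = record
    { to        = λ a → proj₁ (fwd a)
    ; from      = λ b → proj₁ (bwd b)
    ; to-cong   = λ {a} {a′} e → functional e (proj₂ (fwd a)) (proj₂ (fwd a′))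
    ; from-cong = λ {b} {b′} e → injective e (proj₂ (bwd b)) (proj₂ (bwd b′))
    ; inverse   = (λ {b} {a} e → functional e (proj₂ (fwd a)) (proj₂ (bwd b)))
                , (λ {a} {b} e → injective e (proj₂ (bwd b)) (proj₂ (fwd a)))
    }

-- Border paths of down-closed boards

DownClosed : Board → Set
DownClosed Y = ∀ {r r′ c c′} → r ≤ r′ → c ≤ c′ → Y r′ c′ → Y r c

if-elim : ∀ {A B : Set} (P : B → Set) (a? : Dec A) {x y} →
          (A → P x) → (¬ A → P y) → P (if does a? then x else y)
if-elim P (yes a) f g = f a
if-elim P (no ¬a) f g = g ¬a

module _ {Y : Board} (Y? : ∀ r c → Dec (Y r c)) where

  -- Columns are expected in increasing and rows in decreasing order. Branching on `does` makes the
  -- path depend on truth values only, so equivalent boards have equal borders (`border-cong`).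
  border : List ℕ → List ℕ → Path
  border []       []       = []
  border (c ∷ cs) []       = east c tt ∷ border cs []
  border []       (r ∷ rs) = north r ∷ border [] rs
  border (c ∷ cs) (r ∷ rs) =
    if does (Y? r c) then east c tt ∷ border cs (r ∷ rs) else north r ∷ border (c ∷ cs) rs

  cols-border : ∀ cs rs → cols (border cs rs) ≡ cs
  cols-border []       []       = refl
  cols-border (c ∷ cs) []       = cong (c ∷_) (cols-border cs [])
  cols-border []       (r ∷ rs) = cols-border [] rs
  cols-border (c ∷ cs) (r ∷ rs) = if-elim (λ p → cols p ≡ c ∷ cs) (Y? r c)
    (λ _ → cong (c ∷_) (cols-border cs (r ∷ rs)))
    (λ _ → cols-border (c ∷ cs) rs)

  rows-border : ∀ cs rs → rows (border cs rs) ≡ rs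
  rows-border []       []       = refl
  rows-border (c ∷ cs) []       = rows-border cs []
  rows-border []       (r ∷ rs) = cong (r ∷_) (rows-border [] rs)
  rows-border (c ∷ cs) (r ∷ rs) = if-elim (λ p → rows p ≡ r ∷ rs) (Y? r c)
    (λ _ → rows-border cs (r ∷ rs))
    (λ _ → cong (r ∷_) (rows-border (c ∷ cs) rs))

  Sorted-border : DownClosed Y → ∀ cs rs → AllPairs _<_ cs → AllPairs _>_ rs → Sorted Y (border cs rs)
  Sorted-border dc []       []       _        _        = tt
  Sorted-border dc (c ∷ cs) []       (h ∷ hs) _        =
    subst (All _) (sym (cols-border cs [])) h , subst (All _) (sym (rows-border cs [])) [] ,
    Sorted-border dc cs [] hs []
  Sorted-border dc []       (r ∷ rs) _        (k ∷ ks) =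
    subst (All _) (sym (rows-border [] rs)) k , subst (All _) (sym (cols-border [] rs)) [] ,
    Sorted-border dc [] rs [] ks
  Sorted-border dc (c ∷ cs) (r ∷ rs) (h ∷ hs) (k ∷ ks) = if-elim (Sorted Y) (Y? r c)
    (λ y → subst (All _) (sym (cols-border cs (r ∷ rs))) h ,
           subst (All _) (sym (rows-border cs (r ∷ rs)))
             (y ∷ All.map (λ lt → dc (<⇒≤ lt) ≤-refl y) k) ,
           Sorted-border dc cs (r ∷ rs) hs (k ∷ ks))
    (λ ¬y → subst (All _) (sym (rows-border (c ∷ cs) rs)) k ,
            subst (All _) (sym (cols-border (c ∷ cs) rs))
              (¬y ∷ All.map (λ lt y → ¬y (dc ≤-refl (<⇒≤ lt) y)) h) ,
            Sorted-border dc (c ∷ cs) rs (h ∷ hs) ks)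

border-cong : ∀ {Y Y′ : Board} (Y? : ∀ r c → Dec (Y r c)) (Y′? : ∀ r c → Dec (Y′ r c)) →
              (∀ r c → Y r c ⇔ Y′ r c) → ∀ cs rs → border Y? cs rs ≡ border Y′? cs rs
border-cong Y? Y′? e []       []       = refl
border-cong Y? Y′? e (c ∷ cs) []       = cong (east c tt ∷_) (border-cong Y? Y′? e cs [])
border-cong Y? Y′? e []       (r ∷ rs) = cong (north r ∷_) (border-cong Y? Y′? e [] rs)
border-cong Y? Y′? e (c ∷ cs) (r ∷ rs) = trans
  (cong₂ (λ p p′ → if does (Y? r c) then east c tt ∷ p else north r ∷ p′)
    (border-cong Y? Y′? e cs (r ∷ rs)) (border-cong Y? Y′? e (c ∷ cs) rs))
  (cong (λ b → if b then east c tt ∷ border Y′? cs (r ∷ rs) else north r ∷ border Y′? (c ∷ cs) rs)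
    (does-⇔ (e r c) (Y? r c) (Y′? r c)))

-- The order is reversed because `ρ` gives row indices, which grow downwards. The converse of
-- `ordered` follows by trichotomy (`order-reflecting`).
record Pattern {k} (ρ : ℕ → ℕ) (τ : Permutation′ k) (j : Fin k → ℕ) : Set where
  field
    increasing : ∀ {a b} → a <ᶠ b → j a < j b
    ordered    : ∀ {a b} → (τ ⟨$⟩ʳ b) <ᶠ (τ ⟨$⟩ʳ a) → ρ (j a) < ρ (j b)

open Pattern public

⟨$⟩ʳ-injective : ∀ {k} (τ : Permutation′ k) {a b} → τ ⟨$⟩ʳ a ≡ τ ⟨$⟩ʳ b → a ≡ b
⟨$⟩ʳ-injective τ e = trans (sym (inverseˡ τ)) (trans (cong (τ ⟨$⟩ˡ_) e) (inverseˡ τ))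

order-reflecting : ∀ {k} (τ : Permutation′ k) (f : Fin k → ℕ) →
  (∀ {a b} → (τ ⟨$⟩ʳ b) <ᶠ (τ ⟨$⟩ʳ a) → f a < f b) →
  ∀ a b → f a < f b ⇔ (τ ⟨$⟩ʳ b) <ᶠ (τ ⟨$⟩ʳ a)
order-reflecting τ f h a b = mk⇔ back h
  where
  back : f a < f b → (τ ⟨$⟩ʳ b) <ᶠ (τ ⟨$⟩ʳ a)
  back lt with Fin.<-cmp (τ ⟨$⟩ʳ b) (τ ⟨$⟩ʳ a)
  ... | tri< l _ _ = l
  ... | tri≈ _ e _ = contradiction lt (<-irrefl (cong f (sym (⟨$⟩ʳ-injective τ e))))
  ... | tri> _ _ g = contradiction lt (<-asym (h g))

Free : ∀ {k} → Board → Path → (ℕ → ℕ) → Permutation′ k → Set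
Free {k} Y p ρ τ = ∀ (j : Fin k → ℕ) → (∀ a → j a ∈ cols p) → Pattern ρ τ j →
                   ¬ (∀ a b → Y (ρ (j a)) (j b))

triple : ℕ → ℕ → ℕ → Fin 3 → ℕ
triple x y z 0F = x
triple x y z 1F = y
triple x y z 2F = z

triple-∈ : ∀ {x y z l} → x ∈ l → y ∈ l → z ∈ l → ∀ a → triple x y z a ∈ l
triple-∈ hx hy hz 0F = hx
triple-∈ hx hy hz 1F = hy
triple-∈ hx hy hz 2F = hz

triple-increasing : ∀ {x y z} → x < y → y < z → ∀ {a b} → a <ᶠ b → triple x y z a < triple x y z b
triple-increasing h k {0F} {1F} _ = h
triple-increasing h k {0F} {2F} _ = <-trans h k
triple-increasing h k {1F} {2F} _ = k
triple-increasing h k {0F} {0F} ()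
triple-increasing h k {1F} {0F} ()
triple-increasing h k {1F} {1F} (s≤s ())
triple-increasing h k {2F} {0F} ()
triple-increasing h k {2F} {1F} (s≤s ())
triple-increasing h k {2F} {2F} (s≤s (s≤s ()))

module _ {Y : Board} (dc : DownClosed Y) {p : Path} {ρ : ℕ → ℕ} where

  Free⇒No132 : Free Y p ρ ⟨132⟩ → No132 Y p ρ
  Free⇒No132 free {x} {y} {c} x∈ y∈ c∈ x<y y<c ρy ρc yes-Y =
    free (triple x y c) (triple-∈ x∈ y∈ c∈)
      (record { increasing = triple-increasing x<y y<c ; ordered = λ {a} {b} → ord {a} {b} })
      (λ a b → dc (low a) (last b) yes-Y)
    where
    ord : ∀ {a b} → (⟨132⟩ ⟨$⟩ʳ b) <ᶠ (⟨132⟩ ⟨$⟩ʳ a) → ρ (triple x y c a) < ρ (triple x y c b)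
    ord {1F} {0F} _ = <-trans ρy ρc
    ord {1F} {2F} _ = ρy
    ord {2F} {0F} _ = ρc
    ord {0F} {0F} ()
    ord {0F} {1F} ()
    ord {0F} {2F} ()
    ord {1F} {1F} (s≤s (s≤s ()))
    ord {2F} {1F} (s≤s ())
    ord {2F} {2F} (s≤s ())
    low : ∀ a → ρ (triple x y c a) ≤ ρ x
    low 0F = ≤-refl
    low 1F = <⇒≤ (<-trans ρy ρc)
    low 2F = <⇒≤ ρc
    last : ∀ a → triple x y c a ≤ c
    last 0F = <⇒≤ (<-trans x<y y<c)
    last 1F = <⇒≤ y<c
    last 2F = ≤-refl

  No132⇒Free : No132 Y p ρ → Free Y p ρ ⟨132⟩
  No132⇒Free av j j∈ P Yj =
    av (j∈ 0F) (j∈ 1F) (j∈ 2F) (increasing P (s≤s z≤n)) (increasing P (s≤s (s≤s z≤n)))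
       (ordered P {1F} {2F} (s≤s (s≤s z≤n))) (ordered P {2F} {0F} (s≤s z≤n)) (Yj 0F 2F)

  module _ {χ : ℕ → ℕ} (P : Placement Y p ρ χ) where

    -- Transposition turns 132 into 213: the rows `x < y < r` have columns `χ y < χ r < χ x`, and
    -- read by columns the heights are middle, lowest, highest.
    Free⇒No132-turn : Free Y p ρ ⟨213⟩ → No132 (flip Y) (turn p) χ
    Free⇒No132-turn free {x} {y} {r} x∈ y∈ r∈ x<y y<r χy χr yes-Y =
      free j (triple-∈ (χ∈ P y∈′) (χ∈ P r∈′) (χ∈ P x∈′))
        (record { increasing = triple-increasing χy χr ; ordered = λ {a} {b} → ord {a} {b} })
        (λ a b → dc (low a) (last b) yes-Y)
      where
      x∈′ = ∈-cols-turn⁻ p x∈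
      y∈′ = ∈-cols-turn⁻ p y∈
      r∈′ = ∈-cols-turn⁻ p r∈
      j = triple (χ y) (χ r) (χ x)
      ord : ∀ {a b} → (⟨213⟩ ⟨$⟩ʳ b) <ᶠ (⟨213⟩ ⟨$⟩ʳ a) → ρ (j a) < ρ (j b)
      ord {0F} {1F} _ = subst₂ _<_ (sym (ρχ P y∈′)) (sym (ρχ P r∈′)) y<r
      ord {2F} {0F} _ = subst₂ _<_ (sym (ρχ P x∈′)) (sym (ρχ P y∈′)) x<y
      ord {2F} {1F} _ = subst₂ _<_ (sym (ρχ P x∈′)) (sym (ρχ P r∈′)) (<-trans x<y y<r)
      ord {0F} {0F} (s≤s ())
      ord {0F} {2F} (s≤s ())
      ord {1F} {0F} ()
      ord {1F} {1F} ()
      ord {1F} {2F} ()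
      ord {2F} {2F} (s≤s (s≤s ()))
      low : ∀ a → ρ (j a) ≤ r
      low 0F = ≤-trans (≤-reflexive (ρχ P y∈′)) (<⇒≤ y<r)
      low 1F = ≤-reflexive (ρχ P r∈′)
      low 2F = ≤-trans (≤-reflexive (ρχ P x∈′)) (<⇒≤ (<-trans x<y y<r))
      last : ∀ a → j a ≤ χ x
      last 0F = <⇒≤ (<-trans χy χr)
      last 1F = <⇒≤ χr
      last 2F = ≤-refl

    No132-turn⇒Free : No132 (flip Y) (turn p) χ → Free Y p ρ ⟨213⟩
    No132-turn⇒Free av j j∈ Q Yj =
      av (row∈ 2F) (row∈ 0F) (row∈ 1F)
         (ordered Q {2F} {0F} (s≤s (s≤s z≤n))) (ordered Q {0F} {1F} (s≤s z≤n))
         (subst₂ _<_ (sym (χρ P (j∈ 0F))) (sym (χρ P (j∈ 1F))) (increasing Q (s≤s z≤n)))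
         (subst₂ _<_ (sym (χρ P (j∈ 1F))) (sym (χρ P (j∈ 2F))) (increasing Q (s≤s (s≤s z≤n))))
         (subst (Y _) (sym (χρ P (j∈ 2F))) (Yj 1F 2F))
      where
      row∈ : ∀ a → ρ (j a) ∈ cols (turn p)
      row∈ a = ∈-cols-turn p (ρ∈ P (j∈ a))

-- Transversals of a Young diagram

-- 0 outside of the domain.
extend : ∀ {n} → (Fin n → ℕ) → ℕ → ℕ
extend {n} f x with x <? n
... | yes x<n = f (fromℕ< x<n)
... | no  _   = 0

extend-toℕ : ∀ {n} (f : Fin n → ℕ) i → extend f (toℕ i) ≡ f i
extend-toℕ {n} f i with toℕ i <? n
... | yes h = cong f (Fin.fromℕ<-toℕ i h)
... | no  h = contradiction (Fin.toℕ<n i) h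

∀-toℕ : ∀ {n} (P : ℕ → Set) → (∀ (i : Fin n) → P (toℕ i)) → ∀ {x} → x < n → P x
∀-toℕ P h x<n = subst P (Fin.toℕ-fromℕ< x<n) (h (fromℕ< x<n))

upTo-sorted : ∀ n → AllPairs _<_ (upTo n)
upTo-sorted n = AllPairs.applyUpTo⁺₁ id n (λ i<j _ → i<j)

downFrom-sorted : ∀ n → AllPairs _>_ (downFrom n)
downFrom-sorted n = AllPairs.applyDownFrom⁺₁ id n (λ j<i _ → j<i)

≡true-injective : ∀ {a b} → (a ≡ true → b ≡ true) → (b ≡ true → a ≡ true) → a ≡ b
≡true-injective {false} {false} _ _ = refl
≡true-injective {true}  {_}     f _ = sym (f refl)
≡true-injective {false} {true}  _ g = g refl

does⇒true : ∀ {A : Set} (a? : Dec A) → does a? ≡ true → A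
does⇒true (yes a) _ = a

module Shape (Y : YoungDiagram) where

  open IsTransversal
  open Contains

  n : ℕ
  n = #rows Y

  In : Board
  In r c = Σ (r < n) λ r<n → c < rowLength Y (fromℕ< r<n)

  In? : ∀ r c → Dec (In r c)
  In? r c with r <? n
  ... | no  r≮n = no (λ (r<n , _) → r≮n r<n)
  ... | yes r<n with c <? rowLength Y (fromℕ< r<n)
  ...   | yes c< = yes (r<n , c<)
  ...   | no  c≮ = no (λ (_ , c<) → c≮ c<)

  In-down : DownClosed In
  In-down {r} {r′} {c} {c′} r≤r′ c≤c′ (r′<n , c′<) = r<n ,
    ≤-trans (s≤s c≤c′) (≤-trans c′< (decreasing Y
      (subst₂ _≤_ (sym (Fin.toℕ-fromℕ< r<n)) (sym (Fin.toℕ-fromℕ< r′<n)) r≤r′)))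
    where
    r<n = ≤-<-trans r≤r′ r′<n

  In⁺ : ∀ {r c} → c < rowLength Y r → In (toℕ r) c
  In⁺ {r} c< = Fin.toℕ<n r , subst (λ r → _ < rowLength Y r) (sym (Fin.fromℕ<-toℕ r (Fin.toℕ<n r))) c<

  In⁻ : ∀ {r c} → In (toℕ r) c → c < rowLength Y r
  In⁻ {r} (h , c<) = subst (λ r → _ < rowLength Y r) (Fin.fromℕ<-toℕ r h) c<

  cell : ∀ {r c} → In r c → Cell Y
  cell (r<n , c<) = fromℕ< r<n , fromℕ< c<

  row-cell : ∀ {r c} (h : In r c) → toℕ (row {Y} (cell h)) ≡ r
  row-cell (r<n , _) = Fin.toℕ-fromℕ< r<n

  col-cell : ∀ {r c} (h : In r c) → col {Y} (cell h) ≡ c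
  col-cell (_ , c<) = Fin.toℕ-fromℕ< c<

  In-cell : ∀ (x : Cell Y) → In (toℕ (row {Y} x)) (col {Y} x)
  In-cell (r , j) = In⁺ (Fin.toℕ<n j)

  cell-≡ : ∀ {x y : Cell Y} → toℕ (row {Y} x) ≡ toℕ (row {Y} y) → col {Y} x ≡ col {Y} y → x ≡ y
  cell-≡ {r , i} {s , j} e f with Fin.toℕ-injective e
  ... | refl with Fin.toℕ-injective f
  ...   | refl = refl

  -- The top row is the longest, so its length counts the columns; a diagram without rows has none.
  width : ℕ
  width with 0 <? n
  ... | yes 0<n = rowLength Y (fromℕ< 0<n)
  ... | no  _   = 0

  <width⁺ : ∀ {r c} → In r c → c < width
  <width⁺ h with In-down z≤n ≤-refl h
  ... | 0<n , c< with 0 <? n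
  ...   | yes _   = c<
  ...   | no  0≮n = contradiction 0<n 0≮n

  <width⁻ : ∀ {c} → c < width → In 0 c
  <width⁻ c< with 0 <? n
  ... | yes 0<n = 0<n , c<
  <width⁻ () | no _

  p : Path
  p = border In? (upTo width) (downFrom n)

  p-sorted : Sorted In p
  p-sorted = Sorted-border In? In-down _ _ (upTo-sorted width) (downFrom-sorted n)

  ∈cols⁺ : ∀ {c} → c < width → c ∈ cols p
  ∈cols⁺ h = subst (_ ∈_) (sym (cols-border In? (upTo width) (downFrom n))) (∈-upTo⁺ h)

  ∈cols⁻ : ∀ {c} → c ∈ cols p → c < width
  ∈cols⁻ h = ∈-upTo⁻ (subst (_ ∈_) (cols-border In? (upTo width) (downFrom n)) h)

  ∈rows⁺ : ∀ {r} → r < n → r ∈ rows p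
  ∈rows⁺ h = subst (_ ∈_) (sym (rows-border In? (upTo width) (downFrom n))) (∈-downFrom⁺ h)

  ∈rows⁻ : ∀ {r} → r ∈ rows p → r < n
  ∈rows⁻ h = ∈-downFrom⁻ (subst (_ ∈_) (rows-border In? (upTo width) (downFrom n)) h)

  Reads : Filling Y → (ℕ → ℕ) → Set
  Reads T χ = ∀ x → T x ≡ true ⇔ χ (toℕ (row {Y} x)) ≡ col {Y} x

  record Coordinates (T : Filling Y) (ρ χ : ℕ → ℕ) : Set where
    field
      reads     : Reads T χ
      placement : Placement In p ρ χ

  open Coordinates

  -- `χ` is read off the rows and `ρ` off the columns; uniqueness of the one in each line makes them
  -- inverse to each other.
  coordinates : ∀ {T} → IsTransversal Y T → ∃₂ (Coordinates T)
  coordinates {T} t = ρ , χ , record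
    { reads     = read
    ; placement = record
      { ρ∈    = λ c∈ → ∀-toℕ (λ c → ρ c ∈ rows p)
                  (λ i → subst (_∈ rows p) (sym (ρ-i i)) (∈rows⁺ (Fin.toℕ<n _))) (∈cols⁻ c∈)
      ; χρ    = λ c∈ → ∀-toℕ (λ c → χ (ρ c) ≡ c) χρ-i (∈cols⁻ c∈)
      ; χ∈    = λ r∈ → ∀-toℕ (λ r → χ r ∈ cols p)
                  (λ r → subst (_∈ cols p) (sym (χ-r r)) (∈cols⁺ (<width⁺ (In-cell (in-row r))))) (∈rows⁻ r∈)
      ; ρχ    = λ r∈ → ∀-toℕ (λ r → ρ (χ r) ≡ r) ρχ-r (∈rows⁻ r∈)
      ; below = λ c∈ → ∀-toℕ (λ c → In (ρ c) c) below-i (∈cols⁻ c∈)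
      }
    }
    where
    in-row : Fin n → Cell Y
    in-row r = proj₁ (one-per-row t r)
    is-column : (i : Fin width) → IsColumn Y (toℕ i)
    is-column i = let 0<n , c< = <width⁻ (Fin.toℕ<n i) in fromℕ< 0<n , c<
    in-col : Fin width → Cell Y
    in-col i = proj₁ (one-per-column t (toℕ i) (is-column i))
    χ = extend (λ r → col {Y} (in-row r))
    ρ = extend (λ i → toℕ (row {Y} (in-col i)))
    χ-r : ∀ r → χ (toℕ r) ≡ col {Y} (in-row r)
    χ-r = extend-toℕ _
    ρ-i : ∀ i → ρ (toℕ i) ≡ toℕ (row {Y} (in-col i))
    ρ-i = extend-toℕ _
    in-row-row : ∀ r → row {Y} (in-row r) ≡ r
    in-row-row r = proj₁ (proj₁ (proj₂ (one-per-row t r)))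
    in-row-true : ∀ r → T (in-row r) ≡ true
    in-row-true r = proj₂ (proj₁ (proj₂ (one-per-row t r)))
    in-col-col : ∀ i → col {Y} (in-col i) ≡ toℕ i
    in-col-col i = proj₁ (proj₁ (proj₂ (one-per-column t (toℕ i) (is-column i))))
    in-col-true : ∀ i → T (in-col i) ≡ true
    in-col-true i = proj₂ (proj₁ (proj₂ (one-per-column t (toℕ i) (is-column i))))
    read : Reads T χ
    read x = mk⇔
      (λ Tx → trans (χ-r (row {Y} x)) (cong (col {Y}) (proj₂ (proj₂ (one-per-row t (row {Y} x))) (refl , Tx))))
      (λ e → subst (λ x → T x ≡ true)
        (cell-≡ (cong toℕ (in-row-row (row {Y} x))) (trans (sym (χ-r (row {Y} x))) e)) (in-row-true (row {Y} x)))
    χρ-i : ∀ i → χ (ρ (toℕ i)) ≡ toℕ i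
    χρ-i i = trans (cong χ (ρ-i i)) (trans (to (read (in-col i)) (in-col-true i)) (in-col-col i))
    below-i : ∀ i → In (ρ (toℕ i)) (toℕ i)
    below-i i = subst₂ In (sym (ρ-i i)) (in-col-col i) (In-cell (in-col i))
    ρχ-r : ∀ r → ρ (χ (toℕ r)) ≡ toℕ r
    ρχ-r r = trans (cong ρ (trans (χ-r r) (sym i≡)))
               (trans (ρ-i i) (trans (cong (toℕ ∘ row {Y}) same) (cong toℕ (in-row-row r))))
      where
      c<w = <width⁺ (In-cell (in-row r))
      i = fromℕ< c<w
      i≡ : toℕ i ≡ col {Y} (in-row r)
      i≡ = Fin.toℕ-fromℕ< c<w
      same : in-col i ≡ in-row r
      same = proj₂ (proj₂ (one-per-column t (toℕ i) (is-column i))) (sym i≡ , in-row-true r)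

  fill : ∀ {ρ χ} → Placement In p ρ χ → ∃[ T ] IsTransversal Y T × Coordinates T ρ χ
  fill {ρ} {χ} P = T , record
    { one-per-row    = λ r →
        let h = In-χ r in
        cell h , (Fin.toℕ-injective (row-cell h) ,
                  from (read (cell h)) (trans (cong χ (row-cell h)) (sym (col-cell h)))) ,
        λ {y} (e , Ty) → cell-≡ (trans (row-cell h) (sym (cong toℕ e)))
                          (trans (col-cell h) (trans (cong (χ ∘ toℕ) (sym e)) (to (read y) Ty)))
    ; one-per-column = λ c (r , c<) →
        let c∈ = ∈cols⁺ (<width⁺ (In⁺ {r} c<))
            h = below P c∈
        in cell h , (col-cell h ,
                     from (read (cell h)) (trans (cong χ (row-cell h)) (trans (χρ P c∈) (sym (col-cell h))))) ,
           λ {y} (e , Ty) → cell-≡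
             (trans (row-cell h) (trans (cong ρ (sym (trans (to (read y) Ty) e))) (ρχ P (∈rows⁺ (Fin.toℕ<n _)))))
             (trans (col-cell h) (sym e))
    } , record { reads = read ; placement = P }
    where
    T : Filling Y
    T x = does (χ (toℕ (row {Y} x)) ≟ col {Y} x)
    read : Reads T χ
    read x = mk⇔ (does⇒true (_ ≟ _)) (dec-true (_ ≟ _))
    In-χ : ∀ r → In (toℕ r) (χ (toℕ r))
    In-χ r = let r∈ = ∈rows⁺ (Fin.toℕ<n r)
             in subst (λ s → In s (χ (toℕ r))) (ρχ P r∈) (below P (χ∈ P r∈))

  module _ {T ρ χ} (C : Coordinates T ρ χ) {k} (τ : Permutation′ k) where

    private P = placement C

    Avoids⇒Free : Avoids Y T τ → Free In p ρ τ
    Avoids⇒Free av j j∈ Q inside-j = av record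
      { at         = λ a → cell (h a)
      ; ones       = λ a → from (reads C (cell (h a)))
                       (trans (cong χ (row-cell (h a))) (trans (χρ P (j∈ a)) (sym (col-cell (h a)))))
      ; increasing = λ {a} {b} a<b → subst₂ _<_ (sym (col-cell (h a))) (sym (col-cell (h b))) (increasing Q a<b)
      ; same-order = λ a b → subst₂ (λ x y → x < y ⇔ _) (sym (row-cell (h a))) (sym (row-cell (h b)))
                       (order-reflecting τ (ρ ∘ j) (ordered Q) a b)
      ; inside     = λ a b → In⁻ (subst₂ In (sym (row-cell (h a))) (sym (col-cell (h b))) (inside-j a b))
      }
      where
      h : ∀ a → In (ρ (j a)) (j a)
      h a = inside-j a a

    Free⇒Avoids : Free In p ρ τ → Avoids Y T τ
    Free⇒Avoids free c = free j (λ a → ∈cols⁺ (<width⁺ (In-cell (at c a))))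
      (record { increasing = increasing c
              ; ordered    = λ {a} {b} h → subst₂ _<_ (sym (ρ-j a)) (sym (ρ-j b)) (from (same-order c a b) h) })
      (λ a b → subst (λ r → In r (j b)) (sym (ρ-j a)) (In⁺ (inside c a b)))
      where
      j = λ a → col {Y} (at c a)
      ρ-j : ∀ a → ρ (j a) ≡ toℕ (row {Y} (at c a))
      ρ-j a = trans (cong ρ (sym (to (reads C (at c a)) (ones c a)))) (ρχ P (∈rows⁺ (Fin.toℕ<n _)))

  Coordinates-agree : ∀ {T₁ T₂ ρ₁ χ₁ ρ₂ χ₂} → T₁ ≗ T₂ → Coordinates T₁ ρ₁ χ₁ → Coordinates T₂ ρ₂ χ₂ →
                      Agree (cols p) ρ₁ ρ₂ × Agree (rows p) χ₁ χ₂
  Coordinates-agree {T₁} {T₂} {ρ₁} {χ₁} {ρ₂} {χ₂} e C₁ C₂ = agree-ρ , agree-χ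
    where
    P₁ = placement C₁
    P₂ = placement C₂
    agree-χ : Agree (rows p) χ₁ χ₂
    agree-χ {r} r∈ = sym (trans (cong χ₂ (sym (row-cell h)))
      (trans (to (reads C₂ (cell h)) (trans (sym (e (cell h)))
        (from (reads C₁ (cell h)) (trans (cong χ₁ (row-cell h)) (sym (col-cell h)))))) (col-cell h)))
      where
      h : In r (χ₁ r)
      h = subst (λ s → In s (χ₁ r)) (ρχ P₁ r∈) (below P₁ (χ∈ P₁ r∈))
    agree-ρ : Agree (cols p) ρ₁ ρ₂
    agree-ρ {c} c∈ = trans (sym (ρχ P₂ (ρ∈ P₁ c∈)))
      (cong ρ₂ (trans (sym (agree-χ (ρ∈ P₁ c∈))) (χρ P₁ c∈)))

  agree⇒≗ : ∀ {T₁ T₂ ρ₁ χ₁ ρ₂ χ₂} → Coordinates T₁ ρ₁ χ₁ → Coordinates T₂ ρ₂ χ₂ →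
            Agree (rows p) χ₁ χ₂ → T₁ ≗ T₂
  agree⇒≗ C₁ C₂ e x = ≡true-injective
    (λ h → from (reads C₂ x) (trans (sym e′) (to (reads C₁ x) h)))
    (λ h → from (reads C₁ x) (trans e′ (to (reads C₂ x) h)))
    where
    e′ = e (∈rows⁺ (Fin.toℕ<n (row {Y} x)))

  -- `T′` is on the 213 side. The coordinates are quantified because a filling determines them only
  -- on its own rows and columns.
  _~_ : Filling Y → Filling Y → Set
  T′ ~ T = ∃₂ λ ρ χ → ∃₂ λ ρ′ χ′ →
    Coordinates T ρ χ × Coordinates T′ ρ′ χ′ × Matched p ρ χ ρ′ χ′

  ~-functional : ∀ {T₁ T₁′ T₂ T₂′} → T₁ ≗ T₂ → T₁ ~ T₁′ → T₂ ~ T₂′ → T₁′ ≗ T₂′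
  ~-functional e (_ , _ , _ , _ , C₁ , C₁′ , m₁) (_ , _ , _ , _ , C₂ , C₂′ , m₂) =
    let eρ , eχ = Coordinates-agree e C₁′ C₂′
        -- The given side is the 213 side, so the matching is turned before functionality is
        -- applied.
        fχ , _ = Matched-functional
          (λ x∈ → eχ (∈-cols-turn⁻ p x∈)) (λ x∈ → eρ (∈-rows-turn⁻ p x∈)) (Matched-turn m₁) (Matched-turn m₂)
    in agree⇒≗ C₁ C₂ (λ r∈ → fχ (∈-cols-turn p r∈))

  ~-injective : ∀ {T₁ T₁′ T₂ T₂′} → T₁′ ≗ T₂′ → T₁ ~ T₁′ → T₂ ~ T₂′ → T₁ ≗ T₂
  ~-injective e (_ , _ , _ , _ , C₁ , C₁′ , m₁) (_ , _ , _ , _ , C₂ , C₂′ , m₂) =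
    let eρ , eχ = Coordinates-agree e C₁ C₂
        _ , fχ = Matched-functional eρ eχ m₁ m₂
    in agree⇒≗ C₁′ C₂′ fχ

  to-132 : ∀ {T′} → IsTransversal Y T′ → Avoids Y T′ ⟨213⟩ →
           ∃[ T ] (IsTransversal Y T × Avoids Y T ⟨132⟩) × T′ ~ T
  to-132 t′ av =
    let ρ′ , χ′ , C′ = coordinates t′
        P′ = placement C′
        ρ , χ , m , P , no132 , _ = exchange⁻ p-sorted P′ (Free⇒No132-turn In-down P′ (Avoids⇒Free C′ ⟨213⟩ av))
        T , t , C = fill P
    in T , (t , Free⇒Avoids C ⟨132⟩ (No132⇒Free In-down {p} (λ {x} {y} {c} → no132 {x} {y} {c}))) , ρ , χ , ρ′ , χ′ , C , C′ , m

  to-213 : ∀ {T} → IsTransversal Y T → Avoids Y T ⟨132⟩ →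
           ∃[ T′ ] (IsTransversal Y T′ × Avoids Y T′ ⟨213⟩) × T′ ~ T
  to-213 t av =
    let ρ , χ , C = coordinates t
        P = placement C
        ρ′ , χ′ , m , P′ , no132 , _ = exchange p-sorted P (Free⇒No132 In-down {p} (Avoids⇒Free C ⟨132⟩ av))
        T′ , t′ , C′ = fill P′
    in T′ , (t′ , Free⇒Avoids C′ ⟨213⟩ (No132-turn⇒Free In-down P′ no132)) , ρ , χ , ρ′ , χ′ , C , C′ , m

shape-equivalence : ShapeWilfEquivalent ⟨213⟩ ⟨132⟩
shape-equivalence Y = correspondence⇒inverse (S⟨ Y ⟩ ⟨213⟩) (S⟨ Y ⟩ ⟨132⟩)
  (λ a b → proj₁ a ~ proj₁ b)
  (λ (T′ , t′ , av) → let T , h , r = to-132 t′ av in (T , h) , r)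
  (λ (T , t , av) → let T′ , h , r = to-213 t av in (T′ , h) , r)
  ~-functional ~-injective
  where open Shape Y

-- Skew sums

Pattern-cong : ∀ {k ρ ρ′ j j′} {τ : Permutation′ k} → (∀ a → j a ≡ j′ a) → (∀ a → ρ (j a) ≡ ρ′ (j′ a)) →
               Pattern ρ τ j → Pattern ρ′ τ j′
Pattern-cong e f P = record
  { increasing = λ {a} {b} a<b → subst₂ _<_ (e a) (e b) (increasing P a<b)
  ; ordered    = λ {a} {b} lt → subst₂ _<_ (f a) (f b) (ordered P lt)
  }

Pattern? : ∀ {k} ρ (τ : Permutation′ k) j → Dec (Pattern ρ τ j)
Pattern? ρ τ j = map′
  (λ (f , g) → record { increasing = λ {a} {b} → f a b ; ordered = λ {a} {b} → g a b })
  (λ P → (λ a b → increasing P) , (λ a b → ordered P))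
  (Fin.all? (λ a → Fin.all? (λ b → (a Fin.<? b) →-dec (j a <? j b))) ×-dec
   Fin.all? (λ a → Fin.all? (λ b → ((τ ⟨$⟩ʳ b) Fin.<? (τ ⟨$⟩ʳ a)) →-dec (ρ (j a) <? ρ (j b)))))

Pattern-≤ : ∀ {k ρ j} {τ : Permutation′ k} → Pattern ρ τ j → ∀ {a b} → a ≤ᶠ b → j a ≤ j b
Pattern-≤ {j = j} P {a} {b} a≤b with Fin.<-cmp a b
... | tri< lt _ _   = <⇒≤ (increasing P lt)
... | tri≈ _ refl _ = ≤-refl
... | tri> _ _ gt   = contradiction gt (≤⇒≯ a≤b)

Pattern-≥ : ∀ {k ρ j} {τ : Permutation′ k} → Pattern ρ τ j → ∀ {a b} → (τ ⟨$⟩ʳ b) ≤ᶠ (τ ⟨$⟩ʳ a) → ρ (j a) ≤ ρ (j b)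
Pattern-≥ {ρ = ρ} {j} {τ} P {a} {b} τb≤τa with Fin.<-cmp (τ ⟨$⟩ʳ b) (τ ⟨$⟩ʳ a)
... | tri< lt _ _ = <⇒≤ (ordered P lt)
... | tri≈ _ e _  = ≤-reflexive (cong (ρ ∘ j) (sym (⟨$⟩ʳ-injective τ e)))
... | tri> _ _ gt = contradiction gt (≤⇒≯ τb≤τa)

module _ {k m} (σ : Permutation′ k) (τ : Permutation′ m) where

  ⊖-↑ˡ : ∀ a → toℕ ((σ ⊖ τ) ⟨$⟩ʳ (a ↑ˡ m)) ≡ toℕ (σ ⟨$⟩ʳ a) + m
  ⊖-↑ˡ a rewrite Fin.splitAt-↑ˡ k a m =
    trans (Fin.toℕ-cast (+-comm m k) (m ↑ʳ (σ ⟨$⟩ʳ a)))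
          (trans (Fin.toℕ-↑ʳ m _) (+-comm m _))

  ⊖-↑ʳ : ∀ b → toℕ ((σ ⊖ τ) ⟨$⟩ʳ (k ↑ʳ b)) ≡ toℕ (τ ⟨$⟩ʳ b)
  ⊖-↑ʳ b rewrite Fin.splitAt-↑ʳ k m b =
    trans (Fin.toℕ-cast (+-comm m k) ((τ ⟨$⟩ʳ b) ↑ˡ k)) (Fin.toℕ-↑ˡ _ k)

  ↑-cases : (P : Fin (k + m) → Set) → (∀ a → P (a ↑ˡ m)) → (∀ b → P (k ↑ʳ b)) → ∀ x → P x
  ↑-cases P f g x = subst P (Fin.join-splitAt k m x) (on (splitAt k x))
    where
    on : ∀ s → P (join k m s)
    on (inj₁ a) = f a
    on (inj₂ b) = g b

  ↑ˡ<↑ʳ : ∀ (a : Fin k) (b : Fin m) → (a ↑ˡ m) <ᶠ (k ↑ʳ b)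
  ↑ˡ<↑ʳ a b = subst₂ _<_ (sym (Fin.toℕ-↑ˡ a m)) (sym (Fin.toℕ-↑ʳ k b)) (≤-trans (Fin.toℕ<n a) (m≤m+n k (toℕ b)))

  ⊖-↑ʳ<↑ˡ : ∀ a b → ((σ ⊖ τ) ⟨$⟩ʳ (k ↑ʳ b)) <ᶠ ((σ ⊖ τ) ⟨$⟩ʳ (a ↑ˡ m))
  ⊖-↑ʳ<↑ˡ a b = subst₂ _<_ (sym (⊖-↑ʳ b)) (sym (⊖-↑ˡ a)) (≤-trans (Fin.toℕ<n _) (m≤n+m m _))

  module _ {ρ : ℕ → ℕ} where

    Pattern-⊖⁻ : ∀ {J} → Pattern ρ (σ ⊖ τ) J →
      Pattern ρ σ (λ a → J (a ↑ˡ m)) × Pattern ρ τ (λ b → J (k ↑ʳ b)) ×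
      (∀ a b → J (a ↑ˡ m) < J (k ↑ʳ b) × ρ (J (a ↑ˡ m)) < ρ (J (k ↑ʳ b)))
    Pattern-⊖⁻ P =
      record { increasing = λ {a} {b} lt → increasing P (subst₂ _<_ (sym (Fin.toℕ-↑ˡ a m)) (sym (Fin.toℕ-↑ˡ b m)) lt)
             ; ordered = λ {a} {b} lt → ordered P (subst₂ _<_ (sym (⊖-↑ˡ b)) (sym (⊖-↑ˡ a)) (+-monoˡ-< m lt)) } ,
      record { increasing = λ {a} {b} lt →
                 increasing P (subst₂ _<_ (sym (Fin.toℕ-↑ʳ k a)) (sym (Fin.toℕ-↑ʳ k b)) (+-monoʳ-< k lt))
             ; ordered = λ {a} {b} lt → ordered P (subst₂ _<_ (sym (⊖-↑ʳ b)) (sym (⊖-↑ʳ a)) lt) } ,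
      (λ a b → increasing P (↑ˡ<↑ʳ a b) , ordered P (⊖-↑ʳ<↑ˡ a b))

    Pattern-⊖⁺ : ∀ {j i} → Pattern ρ σ j → Pattern ρ τ i → (∀ a b → j a < i b × ρ (j a) < ρ (i b)) →
                 Pattern ρ (σ ⊖ τ) (j ⧺ i)
    Pattern-⊖⁺ {j} {i} P Q h = record
      { increasing = λ {x} {y} → ↑-cases (λ x → ∀ y → x <ᶠ y → (j ⧺ i) x < (j ⧺ i) y)
          (λ a → ↑-cases _
            (λ b lt → subst₂ _<_ (L a) (L b) (increasing P (subst₂ _<_ (Fin.toℕ-↑ˡ a m) (Fin.toℕ-↑ˡ b m) lt)))
            (λ b _ → subst₂ _<_ (L a) (R b) (proj₁ (h a b))))
          (λ a → ↑-cases _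
            (λ b lt → contradiction lt (<-asym (↑ˡ<↑ʳ b a)))
            (λ b lt → subst₂ _<_ (R a) (R b)
              (increasing Q (+-cancelˡ-< k _ _ (subst₂ _<_ (Fin.toℕ-↑ʳ k a) (Fin.toℕ-↑ʳ k b) lt)))))
          x y
      ; ordered = λ {x} {y} → ↑-cases
          (λ x → ∀ y → ((σ ⊖ τ) ⟨$⟩ʳ y) <ᶠ ((σ ⊖ τ) ⟨$⟩ʳ x) → ρ ((j ⧺ i) x) < ρ ((j ⧺ i) y))
          (λ a → ↑-cases _
            (λ b lt → subst₂ (λ u v → ρ u < ρ v) (L a) (L b)
              (ordered P (+-cancelʳ-< m _ _ (subst₂ _<_ (⊖-↑ˡ b) (⊖-↑ˡ a) lt))))
            (λ b _ → subst₂ (λ u v → ρ u < ρ v) (L a) (R b) (proj₂ (h a b))))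
          (λ a → ↑-cases _
            (λ b lt → contradiction lt (<-asym (⊖-↑ʳ<↑ˡ b a)))
            (λ b lt → subst₂ (λ u v → ρ u < ρ v) (R a) (R b)
              (ordered Q (subst₂ _<_ (⊖-↑ʳ b) (⊖-↑ʳ a) lt))))
          x y
      }
      where
      L : ∀ a → j a ≡ (j ⧺ i) (a ↑ˡ m)
      L a = sym (lookup-++ˡ j i a)
      R : ∀ b → i b ≡ (j ⧺ i) (k ↑ʳ b)
      R b = sym (lookup-++ʳ j i b)

-- Permutations avoiding a skew sum

module Framed (N : ℕ) {m : ℕ} (τ : Permutation′ m) where

  -- The Young shape on which the exchange takes place: behind a cell of this board there is room
  -- for `τ`. Positions in `Fin N` make the search for a copy finite.
  Copy : (ℕ → ℕ) → Board
  Copy ρ r c = Σ (Fin m → Fin N) λ j → Pattern ρ τ (toℕ ∘ j) × (∀ b → c < toℕ (j b) × r < ρ (toℕ (j b)))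

  Copy-cong : ∀ {ρ ρ′ r c} ((j , _) : Copy ρ r c) → (∀ b → ρ (toℕ (j b)) ≡ ρ′ (toℕ (j b))) → Copy ρ′ r c
  Copy-cong (j , P , h) e =
    j , Pattern-cong (λ _ → refl) e P , λ b → proj₁ (h b) , subst (_ <_) (e b) (proj₂ (h b))

  Copy? : ∀ ρ r c → Dec (Copy ρ r c)
  Copy? ρ r c = map′ (λ (x , h) → finToFun x , h) (λ (j , h) → funToFin j , respects (λ b → sym (Fin.finToFun-funToFin j b)) h)
    (Fin.any? (λ x → is-copy? (finToFun x)))
    where
    IsCopy : (Fin m → Fin N) → Set
    IsCopy j = Pattern ρ τ (toℕ ∘ j) × (∀ b → c < toℕ (j b) × r < ρ (toℕ (j b)))
    is-copy? : ∀ j → Dec (IsCopy j)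
    is-copy? j = Pattern? ρ τ (toℕ ∘ j) ×-dec
      Fin.all? (λ b → (c <? toℕ (j b)) ×-dec (r <? ρ (toℕ (j b))))
    respects : ∀ {i j} → (∀ b → i b ≡ j b) → IsCopy i → IsCopy j
    respects e (P , h) = Pattern-cong (cong toℕ ∘ e) (cong (ρ ∘ toℕ) ∘ e) P ,
      λ b → subst (λ x → c < toℕ x × r < ρ (toℕ x)) (e b) (h b)

  Copy-down : ∀ ρ → DownClosed (Copy ρ)
  Copy-down ρ r≤ c≤ (j , P , h) = j , P , λ b → ≤-<-trans c≤ (proj₁ (h b)) , ≤-<-trans r≤ (proj₂ (h b))

  Framed-col Framed-row : (ρ χ : ℕ → ℕ) → ℕ → Set
  Framed-col ρ χ c = c < N × Copy ρ (ρ c) c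
  Framed-row ρ χ r = r < N × Copy ρ r (χ r)

  col? : ∀ ρ χ c → Dec (Framed-col ρ χ c)
  col? ρ χ c = (c <? N) ×-dec Copy? ρ (ρ c) c

  row? : ∀ ρ χ r → Dec (Framed-row ρ χ r)
  row? ρ χ r = (r <? N) ×-dec Copy? ρ r (χ r)

  frame : (ρ χ : ℕ → ℕ) → Path
  frame ρ χ = border (Copy? ρ) (filter (col? ρ χ) (upTo N)) (filter (row? ρ χ) (downFrom N))

  frame-cong : ∀ {ρ χ ρ′ χ′} → (∀ r c → Copy ρ r c ⇔ Copy ρ′ r c) →
    (∀ {c} → Framed-col ρ χ c ⇔ Framed-col ρ′ χ′ c) → (∀ {r} → Framed-row ρ χ r ⇔ Framed-row ρ′ χ′ r) →
    frame ρ χ ≡ frame ρ′ χ′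
  frame-cong {ρ} {χ} {ρ′} {χ′} e f g = trans
    (cong₂ (border (Copy? ρ))
      (filter-≐ (col? ρ χ) (col? ρ′ χ′) ((λ {c} → to (f {c})) , (λ {c} → from (f {c}))) (upTo N))
      (filter-≐ (row? ρ χ) (row? ρ′ χ′) ((λ {r} → to (g {r})) , (λ {r} → from (g {r}))) (downFrom N)))
    (border-cong (Copy? ρ) (Copy? ρ′) e (filter (col? ρ′ χ′) (upTo N)) (filter (row? ρ′ χ′) (downFrom N)))

  frame-sorted : ∀ ρ χ → Sorted (Copy ρ) (frame ρ χ)
  frame-sorted ρ χ = Sorted-border (Copy? ρ) (Copy-down ρ) _ _
    (AllPairs.filter⁺ (col? ρ χ) (upTo-sorted N)) (AllPairs.filter⁺ (row? ρ χ) (downFrom-sorted N))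

  module _ {ρ χ : ℕ → ℕ} where

    private
      cs = filter (col? ρ χ) (upTo N)
      rs = filter (row? ρ χ) (downFrom N)

    ∈cols⁺ : ∀ {c} → Framed-col ρ χ c → c ∈ cols (frame ρ χ)
    ∈cols⁺ h = subst (_ ∈_) (sym (cols-border (Copy? ρ) cs rs)) (∈-filter⁺ (col? ρ χ) (∈-upTo⁺ (proj₁ h)) h)

    ∈cols⁻ : ∀ {c} → c ∈ cols (frame ρ χ) → Framed-col ρ χ c
    ∈cols⁻ h = proj₂ (∈-filter⁻ (col? ρ χ) {xs = upTo N} (subst (_ ∈_) (cols-border (Copy? ρ) cs rs) h))

    ∈rows⁺ : ∀ {r} → Framed-row ρ χ r → r ∈ rows (frame ρ χ)
    ∈rows⁺ h = subst (_ ∈_) (sym (rows-border (Copy? ρ) cs rs)) (∈-filter⁺ (row? ρ χ) (∈-downFrom⁺ (proj₁ h)) h)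

    ∈rows⁻ : ∀ {r} → r ∈ rows (frame ρ χ) → Framed-row ρ χ r
    ∈rows⁻ h = proj₂ (∈-filter⁻ (row? ρ χ) {xs = downFrom N} (subst (_ ∈_) (rows-border (Copy? ρ) cs rs) h))

  record IsPerm (ρ χ : ℕ → ℕ) : Set where
    field
      ρ< : ∀ {c} → c < N → ρ c < N
      χ< : ∀ {r} → r < N → χ r < N
      χρ : ∀ {c} → c < N → χ (ρ c) ≡ c
      ρχ : ∀ {r} → r < N → ρ (χ r) ≡ r

  frame-placement : ∀ {ρ χ} → IsPerm ρ χ → Placement (Copy ρ) (frame ρ χ) ρ χ
  frame-placement {ρ} {χ} π = record
    { ρ∈    = λ c∈ → let c< , h = ∈cols⁻ {ρ} {χ} c∈
                     in ∈rows⁺ {ρ} {χ} (IsPerm.ρ< π c< , subst (Copy ρ (ρ _)) (sym (IsPerm.χρ π c<)) h)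
    ; χρ    = λ c∈ → IsPerm.χρ π (proj₁ (∈cols⁻ {ρ} {χ} c∈))
    ; χ∈    = λ r∈ → let r< , h = ∈rows⁻ {ρ} {χ} r∈
                     in ∈cols⁺ {ρ} {χ} (IsPerm.χ< π r< , subst (λ r → Copy ρ r (χ _)) (sym (IsPerm.ρχ π r<)) h)
    ; ρχ    = λ r∈ → IsPerm.ρχ π (proj₁ (∈rows⁻ {ρ} {χ} r∈))
    ; below = λ c∈ → proj₂ (∈cols⁻ {ρ} {χ} c∈)
    }

  -- The outcome of an exchange in either direction: the framed ones are placed anew on the old
  -- board and all others stay.
  record Refill (ρ χ ρ′ χ′ : ℕ → ℕ) : Set where
    field
      isPerm    : IsPerm ρ χ
      placement : Placement (Copy ρ) (frame ρ χ) ρ′ χ′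
      outside-ρ : ∀ {c} → c ∉ cols (frame ρ χ) → ρ′ c ≡ ρ c
      outside-χ : ∀ {r} → r ∉ rows (frame ρ χ) → χ′ r ≡ χ r

  module _ {ρ χ ρ′ χ′} (F : Refill ρ χ ρ′ χ′) where

    open Refill F
    private module π = IsPerm isPerm

    private
      p = frame ρ χ
      P = frame-placement isPerm

    -- Old and new maps both match framed columns with framed rows, so the new inside and the old
    -- outside glue to a permutation.
    refill-isPerm : IsPerm ρ′ χ′
    refill-isPerm = record { ρ< = ρ′< ; χ< = χ′< ; χρ = χρ′ ; ρχ = ρχ′ }
      where
      ρ′< : ∀ {c} → c < N → ρ′ c < N
      ρ′< {c} c< with c ∈? cols p
      ... | yes c∈ = proj₁ (∈rows⁻ {ρ} {χ} (ρ∈ placement c∈))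
      ... | no  c∉ = subst (_< N) (sym (outside-ρ c∉)) (π.ρ< c<)
      χ′< : ∀ {r} → r < N → χ′ r < N
      χ′< {r} r< with r ∈? rows p
      ... | yes r∈ = proj₁ (∈cols⁻ {ρ} {χ} (χ∈ placement r∈))
      ... | no  r∉ = subst (_< N) (sym (outside-χ r∉)) (π.χ< r<)
      χρ′ : ∀ {c} → c < N → χ′ (ρ′ c) ≡ c
      χρ′ {c} c< with c ∈? cols p
      ... | yes c∈ = Placement.χρ placement c∈
      ... | no  c∉ = trans (cong χ′ (outside-ρ c∉))
        (trans (outside-χ (λ r∈ → c∉ (subst (_∈ cols p) (π.χρ c<) (χ∈ P r∈)))) (π.χρ c<))
      ρχ′ : ∀ {r} → r < N → ρ′ (χ′ r) ≡ r
      ρχ′ {r} r< with r ∈? rows p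
      ... | yes r∈ = Placement.ρχ placement r∈
      ... | no  r∉ = trans (cong ρ′ (outside-χ r∉))
        (trans (outside-ρ (λ c∈ → r∉ (subst (_∈ rows p) (π.ρχ r<) (ρ∈ P c∈)))) (π.ρχ r<))

    private
      framed : ∀ {c} → c < N → Copy ρ (ρ′ c) c → c ∈ cols p
      framed {c} c< h with c ∈? cols p
      ... | yes c∈ = c∈
      ... | no  c∉ = ∈cols⁺ {ρ} {χ} (c< , subst (λ r → Copy ρ r c) (outside-ρ c∉) h)

      unframed : ∀ {c} → ¬ Copy ρ (ρ′ c) c → ρ′ c ≡ ρ c
      unframed ¬h = outside-ρ (λ c∈ → ¬h (below placement c∈))

    -- If the cell were off the old board, so would be every one of the new copy, which lies further
    -- right and below. Such ones are not framed, hence unmoved, and the copy was there before.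
    Copy-refill⁻ : ∀ {r c} → Copy ρ′ r c → Copy ρ r c
    Copy-refill⁻ {r} {c} h@(j , _ , k) with Copy? ρ r c
    ... | yes y = y
    ... | no ¬y = Copy-cong h (λ b → unframed
      (λ y → ¬y (Copy-down ρ (<⇒≤ (proj₂ (k b))) (<⇒≤ (proj₁ (k b))) y)))

    -- If a one of the copy is framed, then it has a copy strictly to its right, on which
    -- the induction proceeds; otherwise the copy survives.
    Copy-refill⁺ : ∀ {r c} → Copy ρ r c → Copy ρ′ r c
    Copy-refill⁺ {r} {c} = go N (m≤n+m N c)
      where
      -- `fuel` bounds `N ∸ c`. The next copy lies beyond position `j b`, which is greater than `c`,
      -- so `fuel` decreases.
      go : ∀ fuel {r c} → N ≤ c + fuel → Copy ρ r c → Copy ρ′ r c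
      go fuel {r} {c} bound h@(j , _ , k)
        with Fin.any? (λ b → Copy? ρ (ρ (toℕ (j b))) (toℕ (j b)))
      ... | no none = Copy-cong h (λ b → sym (outside-ρ (λ c∈ → none (b , proj₂ (∈cols⁻ {ρ} {χ} c∈)))))
      go zero {r} {c} bound h@(j , _ , k) | yes (b , h′) =
        contradiction (<-≤-trans (Fin.toℕ<n (j b)) (≤-trans bound (≤-reflexive (+-identityʳ c)))) (<-asym (proj₁ (k b)))
      go (suc fuel) {r} {c} bound h@(j , _ , k) | yes (b , h′) =
        Copy-down ρ′ (<⇒≤ (proj₂ (k b))) (<⇒≤ (proj₁ (k b)))
          (go fuel (≤-trans bound (≤-trans (≤-reflexive (+-suc c fuel)) (+-monoˡ-≤ fuel (proj₁ (k b))))) h′)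

    Copy-refill : ∀ r c → Copy ρ r c ⇔ Copy ρ′ r c
    Copy-refill r c = mk⇔ Copy-refill⁺ Copy-refill⁻

    -- The frame can thus be recovered from the refilled permutation, which is what allows the
    -- exchange to be undone.
    frame-refill : frame ρ χ ≡ frame ρ′ χ′
    frame-refill = frame-cong Copy-refill
      (mk⇔ (λ h → proj₁ h , Copy-refill⁺ (below placement (∈cols⁺ {ρ} {χ} h)))
           (λ (c< , h) → ∈cols⁻ {ρ} {χ} (framed c< (Copy-refill⁻ h))))
      (λ {r} → mk⇔
        (λ h → proj₁ h , Copy-refill⁺ (subst (λ s → Copy ρ s (χ′ r)) (Placement.ρχ placement (∈rows⁺ {ρ} {χ} h))
                                        (below placement (χ∈ placement (∈rows⁺ {ρ} {χ} h)))))
        (λ (r< , h) → row⁻ r< (Copy-refill⁻ h)))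
      where
      row⁻ : ∀ {r} → r < N → Copy ρ r (χ′ r) → Framed-row ρ χ r
      row⁻ {r} r< h with r ∈? rows p
      ... | yes r∈ = ∈rows⁻ {ρ} {χ} r∈
      ... | no  r∉ = r< , subst (Copy ρ r) (outside-χ r∉) h

  FreeIn : ∀ {k} → (ℕ → ℕ) → Permutation′ k → Set
  FreeIn {k} ρ τ = ∀ (j : Fin k → ℕ) → (∀ a → j a < N) → ¬ Pattern ρ τ j

  module _ {k} (σ : Permutation′ (suc k)) {ρ χ : ℕ → ℕ} where

    FreeIn⇒Free : FreeIn ρ (σ ⊖ τ) → Free (Copy ρ) (frame ρ χ) ρ σ
    -- The smallest value of `σ` sits in the lowest row, and `fromℕ k` is the last position: a copy
    -- of `τ` beyond this corner is beyond all ones of `σ`.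
    FreeIn⇒Free free j j∈ P h with h (σ ⟨$⟩ˡ zero) (fromℕ k)
    ... | i , Q , beyond = free (j ⧺ (toℕ ∘ i))
      (↑-cases σ τ (λ x → (j ⧺ (toℕ ∘ i)) x < N)
        (λ a → subst (_< N) (sym (lookup-++ˡ j (toℕ ∘ i) a)) (proj₁ (∈cols⁻ {ρ} {χ} (j∈ a))))
        (λ b → subst (_< N) (sym (lookup-++ʳ j (toℕ ∘ i) b)) (Fin.toℕ<n (i b))))
      (Pattern-⊖⁺ σ τ P Q (λ a b →
        ≤-<-trans (Pattern-≤ P (Fin.≤fromℕ a)) (proj₁ (beyond b)) ,
        ≤-<-trans (Pattern-≥ P (subst (_≤ᶠ (σ ⟨$⟩ʳ a)) (sym (inverseʳ σ)) z≤n)) (proj₂ (beyond b))))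

    -- The `τ` part of an occurrence lies beyond every one of the `σ` part, so those ones are framed
    -- and all cells they span are on the board.
    Free⇒FreeIn : Free (Copy ρ) (frame ρ χ) ρ σ → FreeIn ρ (σ ⊖ τ)
    Free⇒FreeIn free J J< PQ with Pattern-⊖⁻ σ τ PQ
    ... | P , Q , h = free (λ a → J (a ↑ˡ m)) (λ a → ∈cols⁺ {ρ} {χ} (J< (a ↑ˡ m) , copy a a)) P copy
      where
      i : Fin m → Fin N
      i b = fromℕ< (J< (suc k ↑ʳ b))
      i≡ : ∀ b → J (suc k ↑ʳ b) ≡ toℕ (i b)
      i≡ b = sym (Fin.toℕ-fromℕ< (J< (suc k ↑ʳ b)))
      copy : ∀ a a′ → Copy ρ (ρ (J (a ↑ˡ m))) (J (a′ ↑ˡ m))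
      copy a a′ = i , Pattern-cong i≡ (cong ρ ∘ i≡) Q ,
        λ b → subst (_ <_) (i≡ b) (proj₁ (h a′ b)) , subst (λ x → _ < ρ x) (i≡ b) (proj₂ (h a b))

-- The exchange on permutations

opposite-< : ∀ {n} {x y : Fin n} → x <ᶠ y → opposite y <ᶠ opposite x
opposite-< {n} {x} {y} x<y =
  subst₂ _<_ (sym (Fin.opposite-prop y)) (sym (Fin.opposite-prop x)) (∸-monoʳ-< (s≤s x<y) (Fin.toℕ<n y))

opposite-<⁻ : ∀ {n} {x y : Fin n} → opposite y <ᶠ opposite x → x <ᶠ y
opposite-<⁻ {x = x} {y} h =
  subst₂ _<ᶠ_ (Fin.opposite-involutive x) (Fin.opposite-involutive y) (opposite-< h)

module Permutations (N : ℕ) {m : ℕ} (τ : Permutation′ m) where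

  open Framed N τ

  -- Rows are numbered from the top, so the row of a value is its opposite.
  record Coords (π : Permutation′ N) (ρ χ : ℕ → ℕ) : Set where
    field
      isPerm : IsPerm ρ χ
      value  : ∀ i → ρ (toℕ i) ≡ toℕ (opposite (π ⟨$⟩ʳ i))

  open Coords

  coords : ∀ π → ∃₂ (Coords π)
  coords π = extend f , extend g , record
    { isPerm = record
      { ρ< = ∀-toℕ (λ c → extend f c < N) (λ i → subst (_< N) (sym (extend-toℕ f i)) (Fin.toℕ<n _))
      ; χ< = ∀-toℕ (λ c → extend g c < N) (λ i → subst (_< N) (sym (extend-toℕ g i)) (Fin.toℕ<n _))
      ; χρ = ∀-toℕ (λ c → extend g (extend f c) ≡ c) (λ i →
          trans (cong (extend g) (extend-toℕ f i)) (trans (extend-toℕ g _)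
            (cong toℕ (trans (cong (π ⟨$⟩ˡ_) (Fin.opposite-involutive _)) (inverseˡ π)))))
      ; ρχ = ∀-toℕ (λ r → extend f (extend g r) ≡ r) (λ i →
          trans (cong (extend f) (extend-toℕ g i)) (trans (extend-toℕ f _)
            (cong toℕ (trans (cong opposite (inverseʳ π)) (Fin.opposite-involutive i)))))
      }
    ; value = extend-toℕ f
    }
    where
    f g : Fin N → ℕ
    f i = toℕ (opposite (π ⟨$⟩ʳ i))
    g i = toℕ (π ⟨$⟩ˡ opposite i)

  toPermutation : ∀ {ρ χ} → IsPerm ρ χ → ∃[ π ] Coords π ρ χ
  toPermutation {ρ} {χ} P = permutation f g fg gf , record
    { isPerm = P
    ; value  = λ i → sym (trans (cong toℕ (Fin.opposite-involutive (f′ i))) (Fin.toℕ-fromℕ< _))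
    }
    where
    open IsPerm P
    f′ g′ f g : Fin N → Fin N
    f′ i = fromℕ< (ρ< (Fin.toℕ<n i))
    g′ i = fromℕ< (χ< (Fin.toℕ<n i))
    f i = opposite (f′ i)
    g i = g′ (opposite i)
    f′g′ : ∀ i → f′ (g′ i) ≡ i
    f′g′ i = Fin.toℕ-injective (trans (Fin.toℕ-fromℕ< _)
      (trans (cong ρ (Fin.toℕ-fromℕ< _)) (IsPerm.ρχ P (Fin.toℕ<n i))))
    g′f′ : ∀ i → g′ (f′ i) ≡ i
    g′f′ i = Fin.toℕ-injective (trans (Fin.toℕ-fromℕ< _)
      (trans (cong χ (Fin.toℕ-fromℕ< _)) (IsPerm.χρ P (Fin.toℕ<n i))))
    fg : ∀ i → f (g i) ≡ i
    fg i = trans (cong opposite (f′g′ (opposite i))) (Fin.opposite-involutive i)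
    gf : ∀ i → g (f i) ≡ i
    gf i = trans (cong g′ (Fin.opposite-involutive (f′ i))) (g′f′ i)

  module _ {π ρ χ} (C : Coords π ρ χ) {k} (σ : Permutation′ k) where

    PermAvoids⇒FreeIn : PermAvoids π σ → FreeIn ρ σ
    PermAvoids⇒FreeIn av J J< P = av (j , inc , ord)
      where
      j : Fin k → Fin N
      j a = fromℕ< (J< a)
      j≡ : ∀ a → J a ≡ toℕ (j a)
      j≡ a = sym (Fin.toℕ-fromℕ< (J< a))
      inc : ∀ {a b} → a <ᶠ b → j a <ᶠ j b
      inc {a} {b} lt = subst₂ _<_ (j≡ a) (j≡ b) (increasing P lt)
      ρ≡ : ∀ a → ρ (J a) ≡ toℕ (opposite (π ⟨$⟩ʳ j a))
      ρ≡ a = trans (cong ρ (j≡ a)) (value C (j a))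
      ord : ∀ a b → (π ⟨$⟩ʳ j a) <ᶠ (π ⟨$⟩ʳ j b) ⇔ (σ ⟨$⟩ʳ a) <ᶠ (σ ⟨$⟩ʳ b)
      ord a b = mk⇔
        (λ lt → to (order-reflecting σ (ρ ∘ J) (ordered P) b a)
                   (subst₂ _<_ (sym (ρ≡ b)) (sym (ρ≡ a)) (opposite-< lt)))
        (λ lt → opposite-<⁻ (subst₂ _<_ (ρ≡ b) (ρ≡ a) (ordered P lt)))

    FreeIn⇒PermAvoids : FreeIn ρ σ → PermAvoids π σ
    FreeIn⇒PermAvoids free (j , inc , ord) = free (toℕ ∘ j) (λ a → Fin.toℕ<n (j a)) record
      { increasing = inc
      ; ordered    = λ {a} {b} lt → subst₂ _<_ (sym (value C (j a))) (sym (value C (j b)))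
                       (opposite-< (from (ord b a) lt))
      }

  Agree-below : (f g : ℕ → ℕ) → Set
  Agree-below f g = ∀ {x} → x < N → f x ≡ g x

  IsPerm-agree : ∀ {ρ₁ χ₁ ρ₂ χ₂} → IsPerm ρ₁ χ₁ → IsPerm ρ₂ χ₂ → Agree-below ρ₁ ρ₂ → Agree-below χ₁ χ₂
  IsPerm-agree {ρ₁} {χ₁} {ρ₂} {χ₂} P₁ P₂ e {r} r< =
    trans (sym (IsPerm.χρ P₂ (IsPerm.χ< P₁ r<)))
      (cong χ₂ (trans (sym (e (IsPerm.χ< P₁ r<))) (IsPerm.ρχ P₁ r<)))

  Coords-agree : ∀ {π₁ π₂ ρ₁ χ₁ ρ₂ χ₂} → (∀ i → π₁ ⟨$⟩ʳ i ≡ π₂ ⟨$⟩ʳ i) →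
                 Coords π₁ ρ₁ χ₁ → Coords π₂ ρ₂ χ₂ → Agree-below ρ₁ ρ₂
  Coords-agree {ρ₁ = ρ₁} {ρ₂ = ρ₂} e C₁ C₂ = ∀-toℕ (λ c → ρ₁ c ≡ ρ₂ c)
    (λ i → trans (value C₁ i) (trans (cong (toℕ ∘ opposite) (e i)) (sym (value C₂ i))))

  agree⇒≗ : ∀ {π₁ π₂ ρ₁ χ₁ ρ₂ χ₂} → Coords π₁ ρ₁ χ₁ → Coords π₂ ρ₂ χ₂ → Agree-below ρ₁ ρ₂ →
            ∀ i → π₁ ⟨$⟩ʳ i ≡ π₂ ⟨$⟩ʳ i
  agree⇒≗ C₁ C₂ e i =
    trans (sym (Fin.opposite-involutive _)) (trans (cong opposite (Fin.toℕ-injective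
      (trans (sym (value C₁ i)) (trans (e (Fin.toℕ<n i)) (value C₂ i))))) (Fin.opposite-involutive _))

  Copy-agree : ∀ {ρ₁ ρ₂} → Agree-below ρ₁ ρ₂ → ∀ r c → Copy ρ₁ r c ⇔ Copy ρ₂ r c
  Copy-agree e r c = mk⇔ (λ h → Copy-cong h (λ b → e (Fin.toℕ<n _)))
                         (λ h → Copy-cong h (λ b → sym (e (Fin.toℕ<n _))))

  frame-agree : ∀ {ρ₁ χ₁ ρ₂ χ₂} → Agree-below ρ₁ ρ₂ → Agree-below χ₁ χ₂ → frame ρ₁ χ₁ ≡ frame ρ₂ χ₂
  frame-agree {ρ₁} {χ₁} {ρ₂} {χ₂} e f = frame-cong (Copy-agree e)
    (λ {c} → mk⇔ (λ (c< , h) → c< , to (Copy-agree e _ c) (subst (λ r → Copy ρ₁ r c) (e c<) h))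
                 (λ (c< , h) → c< , from (Copy-agree e _ c) (subst (λ r → Copy ρ₂ r c) (sym (e c<)) h)))
    (λ {r} → mk⇔ (λ (r< , h) → r< , to (Copy-agree e r _) (subst (Copy ρ₁ r) (f r<) h))
                 (λ (r< , h) → r< , from (Copy-agree e r _) (subst (Copy ρ₂ r) (sym (f r<)) h)))

  -- `frames` lets the common frame be computed from either permutation, so the relation can be
  -- followed in both directions.
  record _~_ (π′ π : Permutation′ N) : Set where
    field
      {ρ χ ρ′ χ′} : ℕ → ℕ
      C         : Coords π ρ χ
      C′        : Coords π′ ρ′ χ′
      frames    : frame ρ χ ≡ frame ρ′ χ′
      outside   : ∀ {c} → c ∉ cols (frame ρ χ) → ρ c ≡ ρ′ c
      matched   : Matched (frame ρ χ) ρ χ ρ′ χ′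

  private module R = _~_

  agree-inside-outside : ∀ {p : Path} {ρ₁ ρ₂ ρ₁′ ρ₂′} → Agree-below ρ₁ ρ₂ → Agree (cols p) ρ₁′ ρ₂′ →
    (∀ {c} → c ∉ cols p → ρ₁ c ≡ ρ₁′ c) → (∀ {c} → c ∉ cols p → ρ₂ c ≡ ρ₂′ c) → Agree-below ρ₁′ ρ₂′
  agree-inside-outside {p} e f out₁ out₂ {c} c< with c ∈? cols p
  ... | yes c∈ = f c∈
  ... | no  c∉ = trans (sym (out₁ c∉)) (trans (e c<) (out₂ c∉))

  ~-injective : ∀ {π₁ π₁′ π₂ π₂′} → (∀ i → π₁′ ⟨$⟩ʳ i ≡ π₂′ ⟨$⟩ʳ i) → π₁ ~ π₁′ → π₂ ~ π₂′ →
                ∀ i → π₁ ⟨$⟩ʳ i ≡ π₂ ⟨$⟩ʳ i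
  ~-injective e r₁ r₂ = agree⇒≗ (R.C′ r₁) (R.C′ r₂)
    (agree-inside-outside {frame (R.ρ r₁) (R.χ r₁)} eρ (proj₁ inside) (R.outside r₁)
      (λ c∉ → R.outside r₂ (λ c∈ → c∉ (subst (λ p → _ ∈ cols p) (sym same) c∈))))
    where
    eρ = Coords-agree e (R.C r₁) (R.C r₂)
    eχ = IsPerm-agree (isPerm (R.C r₁)) (isPerm (R.C r₂)) eρ
    same : frame (R.ρ r₁) (R.χ r₁) ≡ frame (R.ρ r₂) (R.χ r₂)
    same = frame-agree eρ eχ
    inside = Matched-functional (λ c∈ → eρ (proj₁ (∈cols⁻ {R.ρ r₁} {R.χ r₁} c∈)))
               (λ r∈ → eχ (proj₁ (∈rows⁻ {R.ρ r₁} {R.χ r₁} r∈)))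
               (R.matched r₁) (subst (λ p → Matched p (R.ρ r₂) (R.χ r₂) (R.ρ′ r₂) (R.χ′ r₂)) (sym same) (R.matched r₂))

  ~-functional : ∀ {π₁ π₁′ π₂ π₂′} → (∀ i → π₁ ⟨$⟩ʳ i ≡ π₂ ⟨$⟩ʳ i) → π₁ ~ π₁′ → π₂ ~ π₂′ →
                 ∀ i → π₁′ ⟨$⟩ʳ i ≡ π₂′ ⟨$⟩ʳ i
  ~-functional e r₁ r₂ = agree⇒≗ (R.C r₁) (R.C r₂)
    (agree-inside-outside {p₁} eρ (λ c∈ → proj₂ inside (∈-rows-turn p₁ c∈))
      (λ c∉ → sym (R.outside r₁ c∉))
      (λ c∉ → sym (R.outside r₂ (λ c∈ → c∉ (subst (λ p → _ ∈ cols p) (sym same) c∈)))))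
    where
    p₁ = frame (R.ρ r₁) (R.χ r₁)
    eρ = Coords-agree e (R.C′ r₁) (R.C′ r₂)
    eχ = IsPerm-agree (isPerm (R.C′ r₁)) (isPerm (R.C′ r₂)) eρ
    -- The agreement is known on the 213 side, so the frames are compared there and carried over by
    -- `frames`.
    same : p₁ ≡ frame (R.ρ r₂) (R.χ r₂)
    same = trans (R.frames r₁) (trans (frame-agree eρ eχ) (sym (R.frames r₂)))
    col< : ∀ {c} → c ∈ cols p₁ → c < N
    col< c∈ = proj₁ (∈cols⁻ {R.ρ r₁} {R.χ r₁} c∈)
    row< : ∀ {r} → r ∈ rows p₁ → r < N
    row< r∈ = proj₁ (∈rows⁻ {R.ρ r₁} {R.χ r₁} r∈)
    inside = Matched-functional
      (λ x∈ → eχ (row< (∈-cols-turn⁻ p₁ x∈))) (λ x∈ → eρ (col< (∈-rows-turn⁻ p₁ x∈)))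
      (Matched-turn (R.matched r₁))
      (Matched-turn (subst (λ p → Matched p (R.ρ r₂) (R.χ r₂) (R.ρ′ r₂) (R.χ′ r₂)) (sym same) (R.matched r₂)))

  -- The exchange yields freeness on the old board and frame; the frame is unchanged and every cell
  -- of the new board is on the old one, so no occurrence of `σ ⊖ τ` arises from new copies of `τ`.
  Refill-free : ∀ {ρ χ ρ′ χ′} (F : Refill ρ χ ρ′ χ′) (σ : Permutation′ 3) →
                Free (Copy ρ) (frame ρ χ) ρ′ σ → FreeIn ρ′ (σ ⊖ τ)
  Refill-free {ρ} {χ} {ρ′} {χ′} F σ free = Free⇒FreeIn σ {ρ′} {χ′} (λ j j∈ P h →
    free j (λ a → subst (λ p → j a ∈ cols p) (sym (frame-refill F)) (j∈ a)) P
         (λ a b → Copy-refill⁻ F (h a b)))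

  to-132 : ∀ π′ → PermAvoids π′ (⟨213⟩ ⊖ τ) → ∃[ π ] PermAvoids π (⟨132⟩ ⊖ τ) × π′ ~ π
  to-132 π′ av =
    let ρ′ , χ′ , C′ = coords π′
        p = frame ρ′ χ′
        P′ = frame-placement (isPerm C′)
        dc = Copy-down ρ′
        ρ , χ , m , P , no132 , outρ , outχ = exchange⁻ (frame-sorted ρ′ χ′) P′
          (Free⇒No132-turn dc P′ (FreeIn⇒Free ⟨213⟩ {ρ′} {χ′} (PermAvoids⇒FreeIn C′ (⟨213⟩ ⊖ τ) av)))
        F = record { isPerm = isPerm C′ ; placement = P ; outside-ρ = outρ ; outside-χ = outχ }
        same = frame-refill F
        π , C = toPermutation (refill-isPerm F)
    in π ,
       FreeIn⇒PermAvoids C (⟨132⟩ ⊖ τ)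
         (Refill-free F ⟨132⟩ (No132⇒Free dc {p} (λ {x} {y} {c} → no132 {x} {y} {c}))) ,
       record { C = C ; C′ = C′ ; frames = sym same
              ; outside = λ c∉ → outρ (λ c∈ → c∉ (subst (λ p → _ ∈ cols p) same c∈))
              ; matched = subst (λ p → Matched p ρ χ ρ′ χ′) same m }

  to-213 : ∀ π → PermAvoids π (⟨132⟩ ⊖ τ) → ∃[ π′ ] PermAvoids π′ (⟨213⟩ ⊖ τ) × π′ ~ π
  to-213 π av =
    let ρ , χ , C = coords π
        p = frame ρ χ
        P = frame-placement (isPerm C)
        dc = Copy-down ρ
        ρ′ , χ′ , m , P′ , no132 , outρ , outχ = exchange (frame-sorted ρ χ) P
          (Free⇒No132 dc {p} (FreeIn⇒Free ⟨132⟩ {ρ} {χ} (PermAvoids⇒FreeIn C (⟨132⟩ ⊖ τ) av)))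
        F = record { isPerm = isPerm C ; placement = P′ ; outside-ρ = outρ ; outside-χ = outχ }
        π′ , C′ = toPermutation (refill-isPerm F)
    in π′ ,
       FreeIn⇒PermAvoids C′ (⟨213⟩ ⊖ τ) (Refill-free F ⟨213⟩ (No132-turn⇒Free dc P′ no132)) ,
       record { C = C ; C′ = C′ ; frames = frame-refill F
              ; outside = λ c∉ → sym (outρ c∉) ; matched = m }

wilf-equivalence : ∀ (m : ℕ) (τ : Permutation′ m) → WilfEquivalent ⟨n-1,n-2,n, τ ⟩ ⟨n-2,n,n-1, τ ⟩
wilf-equivalence m τ N = correspondence⇒inverse (S[ N ] ⟨n-1,n-2,n, τ ⟩) (S[ N ] ⟨n-2,n,n-1, τ ⟩)
  (λ a b → proj₁ a ~ proj₁ b)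
  (λ (π′ , av) → let π , h , r = to-132 π′ av in (π , h) , r)
  (λ (π , av) → let π′ , h , r = to-213 π av in (π′ , h) , r)
  ~-functional ~-injective
  where open Permutations N τ

theorem1 : ShapeWilfEquivalent ⟨213⟩ ⟨132⟩ × (∀ (m : ℕ) (τ : Permutation′ m) → WilfEquivalent ⟨n-1,n-2,n, τ ⟩ ⟨n-2,n,n-1, τ ⟩)
theorem1 = shape-equivalence , wilf-equivalence
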